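{- Let $\epsilon\in(0,1]$. There is an algorithm that, given an instance $(\mathcal{X},d)$, $\mathcal{X}=\bigcup_{i=1}^m\mathcal{X}_i$, $k_1,\dots,k_m$ of Fair Max-Min diversification with $|\mathcal{X}|=n$ and $k=\sum_i k_i$, whose metric has doubling dimension $\lambda$, returns a $(1+\epsilon)$-coreset for Fair Max-Min diversification of size $O((8/\epsilon)^\lambda km)$ in running time $O((8/\epsilon)^\lambda kmn)$.
   Context: Fair Max-Min diversification: the input is a finite metric space $(\mathcal{X},d)$ with $|\mathcal{X}|=n$, where $\mathcal{X}=\bigcup_{i=1}^m\mathcal{X}_i$ is partitioned into $m$ disjoint groups, and non-negative integers $k_1,\dots,k_m$ with $k_i\le|\mathcal{X}_i|$. For $\mathcal{S}\subseteq\mathcal{X}$ let $\mathrm{div}(\mathcal{S})=\min_{u,v\in\mathcal{S},u\ne v}d(u,v)$ (the minimum over the empty set is $+\infty$). The optimal diversity is $\ell^*=\max\{\mathrm{div}(\mathcal{S}):\mathcal{S}\subseteq\mathcal{X},\ |\mathcal{S}\cap\mathcal{X}_i|=k_i\ \forall i\in[m]\}$. Coreset: $\mathcal{T}\subseteq\mathcal{X}$ is an $\alpha$-coreset if there is $\mathcal{T}'\subseteq\mathcal{T}$ with $|\mathcal{T}'\cap\mathcal{X}_i|=k_i$ for all $i\in[m]$ and $\mathrm{div}(\mathcal{T}')\ge\ell^*/\alpha$. Doubling dimension: write $\mathbf{B}(p,r)=\{q\in\mathcal{X}: d(p,q)<r\}$. The doubling dimension of $\mathcal{X}$ is the smallest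 integer $\lambda$ such that for all $p\in\mathcal{X}$ and all $0<r'\le r/2$, the ball $\mathbf{B}(p,r)$ can be covered by at most $(r/r')^\lambda$ balls of radius $r'$. A distance evaluation costs $O(1)$ time. -}

module Defs where

open import Algebra.Bundles using (CommutativeRing; Semiring)
import Algebra.Definitions.RawSemiring as RawSemiringDefs
open import Data.Bool.Base using (Bool; true; false; not; if_then_else_; _∧_)
open import Data.Fin.Base using (Fin; toℕ; fromℕ<)
import Data.Fin.Properties as Fin
open import Data.Fin.Subset using (Subset; inside; outside; ∣_∣; _∩_; _∈_; _⊆_)
open import Data.Fin.Subset.Properties using (_∈?_)
open import Data.List.Base
  using (List; []; _∷_; _++_; map; filter; allFin; cartesianProduct)
import Data.List.Extrema as Extrema
open import Data.Maybe.Base using () renaming (map to map⁺)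
open import Data.Nat.Base as ℕ using (ℕ; zero; suc; _≡ᵇ_; _≤ᵇ_)
import Data.Nat.Properties as ℕ
open import Data.Product.Base using (Σ-syntax; ∃-syntax; _×_; _,_)
open import Data.Vec.Base as Vec using (tabulate)
import Data.Vec.Functional as Vector
open import Function.Metric.Structures using (IsGeneralMetric)
open import Level using (Level; _⊔_) renaming (suc to lsuc)
open import Relation.Binary.Bundles using (DecTotalOrder; TotalOrder)
open import Relation.Binary.Core using (Rel)
open import Relation.Binary.Structures using (IsDecTotalOrder)
import Relation.Binary.Construct.NonStrictToStrict as ToStrict
import Relation.Binary.Construct.Add.Supremum.Equality as SupEquality
import Relation.Binary.Construct.Add.Supremum.NonStrict as SupOrder
open import Relation.Binary.PropositionalEquality.Core using (_≡_)
open import Relation.Nullary.Construct.Add.Supremum using (_⁺; ⊤⁺; [_])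
open import Relation.Nullary.Decidable.Core using (Dec; does; yes; no; ¬?; _×-dec_)
open import Relation.Unary using (Pred)

-- ℝ enters only through its ordered-field structure, with the exact
-- comparisons of the real-RAM model; nothing is assumed of 0# ⁻¹.
record OrderedField (c ℓ₁ ℓ₂ : Level) : Set (lsuc (c ⊔ ℓ₁ ⊔ ℓ₂)) where
  infix  4 _≤_
  infix  8 _⁻¹
  infixl 7 _/_
  field
    commutativeRing : CommutativeRing c ℓ₁

  open CommutativeRing commutativeRing public

  field
    _≤_             : Rel Carrier ℓ₂
    isDecTotalOrder : IsDecTotalOrder _≈_ _≤_
    +-monoˡ-≤       : ∀ z {x y} → x ≤ y → x + z ≤ y + z
    *-nonNegative   : ∀ {x y} → 0# ≤ x → 0# ≤ y → 0# ≤ x * y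
    0≉1             : 0# ≉ 1#
    _⁻¹             : Carrier → Carrier
    ⁻¹-inverseʳ     : ∀ x → x ≉ 0# → x * x ⁻¹ ≈ 1#

  open IsDecTotalOrder isDecTotalOrder public
    using (_≤?_; _≟_; isTotalOrder; isPartialOrder)

  decTotalOrder : DecTotalOrder c ℓ₁ ℓ₂
  decTotalOrder = record { isDecTotalOrder = isDecTotalOrder }

  open ToStrict _≈_ _≤_ public using (_<_)
  open RawSemiringDefs (Semiring.rawSemiring semiring) public using (_^_) renaming (_×_ to _·_)

  _/_ : Carrier → Carrier → Carrier
  x / y = x * y ⁻¹

  fromℕ : ℕ → Carrier
  fromℕ k = k · 1#

  open SupEquality _≈_ public using (_≈⁺_)
  open SupOrder _≤_ public using (_≤⁺_; ≤⁺-isTotalOrder)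

  totalOrder⁺ : TotalOrder c (c ⊔ ℓ₁) (c ⊔ ℓ₂)
  totalOrder⁺ = record { isTotalOrder = ≤⁺-isTotalOrder isTotalOrder }

allSubsets : ∀ n → List (Subset n)
allSubsets zero    = Vec.[] ∷ []
allSubsets (suc n) = map (outside Vec.∷_) (allSubsets n) ++
                     map (inside  Vec.∷_) (allSubsets n)

-- A partition into m labelled, possibly empty, groups is a map to Fin m.
class : ∀ {n m} → (Fin n → Fin m) → Fin m → Subset n
class group i = tabulate (λ x → does (group x Fin.≟ i))

module Diversification {c ℓ₁ ℓ₂ : Level} (F : OrderedField c ℓ₁ ℓ₂) where
  open OrderedField F
  open Extrema totalOrder⁺ using (min; max)

  record Instance : Set (c ⊔ ℓ₁ ⊔ ℓ₂) where
    field
      n m      : ℕ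
      d        : Fin n → Fin n → Carrier
      isMetric : IsGeneralMetric _≡_ _≈_ _≤_ 0# _+_ d
      group    : Fin n → Fin m
      quota    : Fin m → ℕ
      quota≤   : ∀ i → quota i ℕ.≤ ∣ class group i ∣

    k : ℕ
    k = Vector.foldr ℕ._+_ 0 quota

    Fair : Pred (Subset n) _
    Fair S = ∀ i → ∣ S ∩ class group i ∣ ≡ quota i

    fair? : ∀ S → Dec (Fair S)
    fair? S = Fin.all? (λ i → ∣ S ∩ class group i ∣ ℕ.≟ quota i)

    distinctPairs : Subset n → List (Fin n × Fin n)
    distinctPairs S =
      filter (λ (u , v) → u ∈? S ×-dec v ∈? S ×-dec ¬? (u Fin.≟ v))
             (cartesianProduct (allFin n) (allFin n))

    div : Subset n → Carrier ⁺
    div S = min ⊤⁺ (map (λ (u , v) → [ d u v ]) (distinctPairs S))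

    -- The seed [ 0# ] never matters: some fair set exists by quota≤, and
    -- 0# is a lower bound of div.
    ℓ* : Carrier ⁺
    ℓ* = max [ 0# ] (map div (filter fair? (allSubsets n)))

    IsCoreset : Carrier → Subset n → Set (c ⊔ ℓ₂)
    IsCoreset α T =
      ∃[ T′ ] T′ ⊆ T × Fair T′ × (map⁺ (_/ α) ℓ* ≤⁺ div T′)

    Ball : Fin n → Carrier → Pred (Fin n) (ℓ₁ ⊔ ℓ₂)
    Ball p r q = d p q < r

    Covers : Subset n → Carrier → Pred (Fin n) (ℓ₁ ⊔ ℓ₂) → Set (ℓ₁ ⊔ ℓ₂)
    Covers Q r A = ∀ {x} → A x → ∃[ q ] q ∈ Q × Ball q r x

    Doubling : ℕ → Set (c ⊔ ℓ₁ ⊔ ℓ₂)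
    Doubling dim = ∀ p r r′ → 0# < r′ → r′ ≤ r / fromℕ 2 →
      ∃[ Q ] fromℕ ∣ Q ∣ ≤ (r / r′) ^ dim × Covers Q r′ (Ball p r)

    -- No negative exponent is possible once there is a point, as r / r′ ≥ 2
    -- while a ball about that point needs at least one covering ball.
    IsDoublingDimension : ℕ → Set (c ⊔ ℓ₁ ⊔ ℓ₂)
    IsDoublingDimension dim =
      Doubling dim × (∀ dim′ → Doubling dim′ → dim ℕ.≤ dim′)

data Sort : Set where
  nat real : Sort

-- Real-RAM programs.  Memory consists of arrays, named by natural numbers,
-- of each sort; the instance, ε and the doubling dimension are read-only
-- inputs.  There is no multiplication of naturals and no rounding of reals,
-- whose unit-cost versions would make the model unreasonably strong.
infixl 6 _+ₑ_ _∸ₑ_ _-ₑ_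
infixl 7 _*ₑ_ _/ₑ_

data Exp : Sort → Set where
  lit           : ℕ → Exp nat
  cell          : (τ : Sort) (array : ℕ) (index : Exp nat) → Exp τ
  #points       : Exp nat
  #groups       : Exp nat
  dimension     : Exp nat
  groupOf       : (point : Exp nat) → Exp nat
  quotaOf       : (group : Exp nat) → Exp nat
  epsilon       : Exp real
  distance      : (point point′ : Exp nat) → Exp real
  toReal        : Exp nat → Exp real
  _+ₑ_          : ∀ {τ} → Exp τ → Exp τ → Exp τ
  _∸ₑ_          : Exp nat → Exp nat → Exp nat
  _-ₑ_ _*ₑ_ _/ₑ_ : Exp real → Exp real → Exp real

infix  4 _≤ₑ_
infixr 3 _andₑ_

data Test : Set where
  _≤ₑ_  : ∀ {τ} → Exp τ → Exp τ → Test
  notₑ  : Test → Test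
  _andₑ_ : Test → Test → Test

infixr 1 _︔_

data Cmd : Set where
  skip   : Cmd
  store  : (τ : Sort) (array : ℕ) (index : Exp nat) → Exp τ → Cmd
  _︔_    : Cmd → Cmd → Cmd
  branch : Test → Cmd → Cmd → Cmd
  while  : Test → Cmd → Cmd

costₑ : ∀ {τ} → Exp τ → ℕ
costₑ (lit _)        = 1
costₑ (cell _ _ i)   = 1 ℕ.+ costₑ i
costₑ #points        = 1
costₑ #groups        = 1
costₑ dimension      = 1
costₑ (groupOf e)    = 1 ℕ.+ costₑ e
costₑ (quotaOf e)    = 1 ℕ.+ costₑ e
costₑ epsilon        = 1
costₑ (distance e f) = 1 ℕ.+ costₑ e ℕ.+ costₑ f
costₑ (toReal e)     = 1 ℕ.+ costₑ e
costₑ (e +ₑ f)       = 1 ℕ.+ costₑ e ℕ.+ costₑ f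
costₑ (e ∸ₑ f)       = 1 ℕ.+ costₑ e ℕ.+ costₑ f
costₑ (e -ₑ f)       = 1 ℕ.+ costₑ e ℕ.+ costₑ f
costₑ (e *ₑ f)       = 1 ℕ.+ costₑ e ℕ.+ costₑ f
costₑ (e /ₑ f)       = 1 ℕ.+ costₑ e ℕ.+ costₑ f

costₜ : Test → ℕ
costₜ (e ≤ₑ f)   = 1 ℕ.+ costₑ e ℕ.+ costₑ f
costₜ (notₑ b)   = 1 ℕ.+ costₜ b
costₜ (b andₑ c) = 1 ℕ.+ costₜ b ℕ.+ costₜ c

atℕ : ∀ {a} {A : Set a} {n} → A → (Fin n → A) → ℕ → A
atℕ {n = n} default f i with i ℕ.<? n
... | yes i<n = f (fromℕ< i<n)
... | no  _   = default

module RealRAM {c ℓ₁ ℓ₂ : Level} (F : OrderedField c ℓ₁ ℓ₂) where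
  open OrderedField F
  open Diversification F

  record State : Set c where
    constructor state
    field
      nats  : ℕ → ℕ → ℕ
      reals : ℕ → ℕ → Carrier

  open State public

  initial : State
  initial = state (λ _ _ → 0) (λ _ _ → 0#)

  update : ∀ {a} {A : Set a} → (ℕ → ℕ → A) → ℕ → ℕ → A → (ℕ → ℕ → A)
  update f a i v b j = if (a ≡ᵇ b) ∧ (i ≡ᵇ j) then v else f b j

  -- A program returns the set whose characteristic vector is nat-array 0.
  output : ∀ {n} → State → Subset n
  output s = tabulate (λ x → 1 ≤ᵇ nats s 0 (toℕ x))

  module Semantics (I : Instance) (ε : Carrier) (dim : ℕ) where
    open Instance I

    evalℕ : State → Exp nat → ℕ
    evalℕ s (lit k)        = k
    evalℕ s (cell nat a i) = nats s a (evalℕ s i)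
    evalℕ s #points        = n
    evalℕ s #groups        = m
    evalℕ s dimension      = dim
    evalℕ s (groupOf e)    = atℕ 0 (λ x → toℕ (group x)) (evalℕ s e)
    evalℕ s (quotaOf e)    = atℕ 0 quota (evalℕ s e)
    evalℕ s (e +ₑ f)       = evalℕ s e ℕ.+ evalℕ s f
    evalℕ s (e ∸ₑ f)       = evalℕ s e ℕ.∸ evalℕ s f

    evalℝ : State → Exp real → Carrier
    evalℝ s (cell real a i) = reals s a (evalℕ s i)
    evalℝ s epsilon         = ε
    evalℝ s (distance e f)  =
      atℕ 0# (λ x → atℕ 0# (λ y → d x y) (evalℕ s f)) (evalℕ s e)
    evalℝ s (toReal e)      = fromℕ (evalℕ s e)
    evalℝ s (e +ₑ f)        = evalℝ s e + evalℝ s f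
    evalℝ s (e -ₑ f)        = evalℝ s e - evalℝ s f
    evalℝ s (e *ₑ f)        = evalℝ s e * evalℝ s f
    evalℝ s (e /ₑ f)        = evalℝ s e / evalℝ s f

    test : State → Test → Bool
    test s (_≤ₑ_ {nat}  e f) = evalℕ s e ≤ᵇ evalℕ s f
    test s (_≤ₑ_ {real} e f) = does (evalℝ s e ≤? evalℝ s f)
    test s (notₑ b)          = not (test s b)
    test s (b andₑ c)        = test s b ∧ test s c

    assign : State → (τ : Sort) → ℕ → ℕ → Exp τ → State
    assign s nat  a i e = record s { nats  = update (nats s) a i (evalℕ s e) }
    assign s real a i e = record s { reals = update (reals s) a i (evalℝ s e) }

    infix 2 ⟨_,_⟩⇓⟨_,_⟩

    -- ⟨ P , s ⟩⇓⟨ s′ , t ⟩: started in s, P halts in s′ after t steps.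
    data ⟨_,_⟩⇓⟨_,_⟩ : Cmd → State → State → ℕ → Set c where
      ⇓-skip : ∀ {s} → ⟨ skip , s ⟩⇓⟨ s , 1 ⟩
      ⇓-assign : ∀ {s a i τ} {e : Exp τ} →
        ⟨ store τ a i e , s ⟩⇓⟨ assign s τ a (evalℕ s i) e
                            , 1 ℕ.+ costₑ i ℕ.+ costₑ e ⟩
      ⇓-seq : ∀ {P Q s s′ s″ t u} →
        ⟨ P , s ⟩⇓⟨ s′ , t ⟩ → ⟨ Q , s′ ⟩⇓⟨ s″ , u ⟩ →
        ⟨ P ︔ Q , s ⟩⇓⟨ s″ , t ℕ.+ u ⟩
      ⇓-then : ∀ {b P Q s s′ t} → test s b ≡ true → ⟨ P , s ⟩⇓⟨ s′ , t ⟩ →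
        ⟨ branch b P Q , s ⟩⇓⟨ s′ , 1 ℕ.+ costₜ b ℕ.+ t ⟩
      ⇓-else : ∀ {b P Q s s′ t} → test s b ≡ false → ⟨ Q , s ⟩⇓⟨ s′ , t ⟩ →
        ⟨ branch b P Q , s ⟩⇓⟨ s′ , 1 ℕ.+ costₜ b ℕ.+ t ⟩
      ⇓-stop : ∀ {b P s} → test s b ≡ false →
        ⟨ while b P , s ⟩⇓⟨ s , 1 ℕ.+ costₜ b ⟩
      ⇓-loop : ∀ {b P s s′ s″ t u} → test s b ≡ true →
        ⟨ P , s ⟩⇓⟨ s′ , t ⟩ → ⟨ while b P , s′ ⟩⇓⟨ s″ , u ⟩ →
        ⟨ while b P , s ⟩⇓⟨ s″ , 1 ℕ.+ costₜ b ℕ.+ t ℕ.+ u ⟩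

{-# OPTIONS --safe #-}

-- Run farthest-point selection in every group for about D k rounds, D = (8/ε)^λ.
-- Let S be an optimal fair set, R its diversity and h = Rε/8, and replace the points
-- of S one at a time.  A point within 2h of a centre of its group moves there.
-- Otherwise the centres of that group are pairwise at least 2h apart, and at most D
-- of them lie in any ball of radius R: it is covered by D balls of radius h, each
-- with at most one centre.  The other k - 1 points thus cannot block all of the more
-- than D (k - 1) centres, and the point moves to a centre at distance ≥ R from all
-- others.  Every distance loses at most 4h, and R - 4h ≥ R / (1 + ε) as ε ≤ 1.
module Submission where

open import Defs
import Algebra.Properties.Ring as RingProperties
import Algebra.Properties.Semiring.Exp as SemiringExp
import Algebra.Properties.Semiring.Mult as SemiringMult
import Algebra.Solver.Ring.NaturalCoefficients.Default as SemiringSolver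
open import Data.Bool.Base using (Bool; true; false; if_then_else_; not; _∧_)
open import Data.Bool.Properties using (∧-conicalˡ; ∧-conicalʳ; not-injective)
open import Data.Empty using (⊥-elim)
open import Data.Fin.Base using (Fin; zero; suc; toℕ; fromℕ<)
import Data.Fin.Properties as Fin
open import Data.Fin.Subset using (Subset; inside; outside; ∣_∣; _∩_; _∈_; _⊆_; _-_; ⊤)
open import Data.Fin.Subset.Properties
  using ( _∈?_; ∈⊤; ∣⊤∣≡n; ∣p∣≤n; x∈p⇒∣p-x∣<∣p∣; x∈p∧x≢y⇒x∈p-y; p─q⊆p; p─⊥≡p; ⊆-antisym; s⊆s; out⊆
        ; Empty-unique; ∣⊥∣≡0; x∈p∩q⁺; x∈p∩q⁻)
open import Data.List.Base
  using ( List; []; _∷_; _++_; length; map; filter; allFin; upTo; concatMap; cartesianProduct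
        ; cartesianProductWith)
import Data.List.Extrema as Extrema
import Data.List.Membership.DecPropositional as DecMembership
open import Data.List.Membership.Propositional using (find) renaming (_∈_ to _∈ˡ_)
open import Data.List.Membership.Propositional.Properties
  using ( ∈-filter⁺; ∈-filter⁻; ∈-allFin; ∈-map⁻; ∈-map⁺; ∈-cartesianProduct⁺
        ; ∈-cartesianProductWith⁺; ∈-concatMap⁺; ∈-upTo⁺)
open import Data.List.Properties using (length-map; length-++; length-upTo)
open import Data.List.Relation.Binary.Pointwise using (Pointwise; []; _∷_)
open import Data.List.Relation.Unary.All as All using (All; []; _∷_)
import Data.List.Relation.Unary.All.Properties as All
open import Data.List.Relation.Unary.AllPairs as AllPairs using (AllPairs; []; _∷_)
import Data.List.Relation.Unary.AllPairs.Properties as AllPairs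
open import Data.List.Relation.Unary.Any as Any using (Any; here; there)
open import Data.List.Relation.Unary.Unique.Propositional using (Unique)
open import Data.List.Relation.Unary.Unique.Propositional.Properties using (allFin⁺; filter⁺)
open import Data.Maybe.Base using () renaming (map to map⁺)
open import Data.Nat.Base as ℕ using (ℕ; zero; suc; z≤n; s≤s; _≡ᵇ_; _≤ᵇ_)
import Data.Nat.Properties as ℕ
open import Algebra.Properties.CommutativeMonoid.Sum ℕ.+-0-commutativeMonoid
  using (sum; ∑-distrib-+; sum-cong-≗; sum-replicate-zero)
open import Data.Nat.Solver using (module +-*-Solver)
open import Data.Product.Base using (Σ-syntax; ∃-syntax; _×_; _,_; proj₁; proj₂)
open import Data.Sum.Base as Sum using (_⊎_; inj₁; inj₂; [_,_]′)
open import Data.Vec.Base using ([]; _∷_; tabulate; here; there)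
import Data.Vec.Functional as Vector
open import Data.Vec.Properties using (lookup⇒[]=; []=⇒lookup; lookup∘tabulate)
open import Function.Base using (_∘_; id)
open import Function.Metric.Structures using (module IsGeneralMetric)
open import Level using (Level; _⊔_)
open import Relation.Binary.Bundles using (DecTotalOrder)
open import Relation.Binary.Construct.Add.Supremum.NonStrict using ([_]; _≤⊤⁺; [≤]-injective)
open import Relation.Binary.Core using (Rel)
open import Relation.Binary.Definitions using (Symmetric)
import Relation.Binary.Properties.DecTotalOrder as DecTotalOrderProperties
open import Relation.Binary.PropositionalEquality as ≡ using (_≡_; _≢_)
import Relation.Binary.Reasoning.PartialOrder as PartialOrderReasoning
open import Relation.Nullary.Construct.Add.Supremum using (⊤⁺; [_])
open import Relation.Nullary.Decidable using (Dec; does; yes; no; ¬?; _×-dec_; dec-true; dec-false)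
open import Relation.Nullary.Negation.Core using (¬_; contradiction)
open import Relation.Unary using (Pred; Decidable)

-- Counting in finite sets

-- The program never learns `R`: a farthest-point order is a net at every scale simultaneously, so
-- the analysis may fix the scale afterwards. The constant 8 collects three factors of two. A ball
-- of radius h separates centres only if these are 2h apart, so a point may have to move by 2h; both
-- ends of a distance may move; and 1 + ε, by which the loss is multiplied when the quotient R / (1
-- + ε) is cleared, may be as large as 2. The replacements are sequential because a point that jumps
-- far away must avoid the current positions of all others, moved or not. The ordered field need not
-- be Archimedean, so D k may exceed every natural number. The rounds are therefore also capped at n
-- + 1, which suffices because n + 1 centres cannot be pairwise distinct: then every point has a
-- centre of its group within 2h.

does≡true⇒ : ∀ {a} {A : Set a} (A? : Dec A) → does A? ≡ true → A
does≡true⇒ (yes a) _ = a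

does≡false⇒¬ : ∀ {a} {A : Set a} (A? : Dec A) → does A? ≡ false → ¬ A
does≡false⇒¬ (no ¬a) _ = ¬a

module _ {n : ℕ} where

  ∈-tabulate⁻ : ∀ {f : Fin n → Bool} {x} → x ∈ tabulate f → f x ≡ true
  ∈-tabulate⁻ {f} {x} x∈ = ≡.trans (≡.sym (lookup∘tabulate f x)) ([]=⇒lookup x∈)

  ∈-tabulate⁺ : ∀ {f : Fin n → Bool} {x} → f x ≡ true → x ∈ tabulate f
  ∈-tabulate⁺ {f} {x} fx = lookup⇒[]= x (tabulate f) (≡.trans (lookup∘tabulate f x) fx)

  ⟦_⟧ : ∀ {p} {P : Pred (Fin n) p} → Decidable P → Subset n
  ⟦ P? ⟧ = tabulate (does ∘ P?)

  ∈-⟦⟧⁻ : ∀ {p} {P : Pred (Fin n) p} (P? : Decidable P) {x} → x ∈ ⟦ P? ⟧ → P x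
  ∈-⟦⟧⁻ P? {x} = does≡true⇒ (P? x) ∘ ∈-tabulate⁻

  ∈-⟦⟧⁺ : ∀ {p} {P : Pred (Fin n) p} (P? : Decidable P) {x} → P x → x ∈ ⟦ P? ⟧
  ∈-⟦⟧⁺ P? {x} = ∈-tabulate⁺ ∘ dec-true (P? x)

∣p∣≤1+∣p-x∣ : ∀ {n} (p : Subset n) x → ∣ p ∣ ℕ.≤ suc ∣ p - x ∣
∣p∣≤1+∣p-x∣ (inside  ∷ p) zero    = s≤s (ℕ.≤-reflexive (≡.cong ∣_∣ (≡.sym (p─⊥≡p p))))
∣p∣≤1+∣p-x∣ (outside ∷ p) zero    = ℕ.m≤n⇒m≤1+n (ℕ.≤-reflexive (≡.cong ∣_∣ (≡.sym (p─⊥≡p p))))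
∣p∣≤1+∣p-x∣ (inside  ∷ p) (suc x) = s≤s (∣p∣≤1+∣p-x∣ p x)
∣p∣≤1+∣p-x∣ (outside ∷ p) (suc x) = ∣p∣≤1+∣p-x∣ p x

x∉p-x : ∀ {n} (p : Subset n) x → ¬ (x ∈ p - x)
x∉p-x (inside  ∷ p) zero    ()
x∉p-x (outside ∷ p) zero    ()
x∉p-x (s ∷ p)       (suc x) (there x∈) = x∉p-x p x x∈

∣p∣≤length : ∀ {n} (xs : List (Fin n)) (p : Subset n) → (∀ {x} → x ∈ p → x ∈ˡ xs) → ∣ p ∣ ℕ.≤ length xs
∣p∣≤length {n} [] p p⊆xs = ℕ.≤-reflexive
  (≡.trans (≡.cong ∣_∣ (Empty-unique (λ (x , x∈p) → contradiction (p⊆xs x∈p) λ ()))) (∣⊥∣≡0 n))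
∣p∣≤length (y ∷ xs) p p⊆xs = ℕ.≤-trans (∣p∣≤1+∣p-x∣ p y) (s≤s (∣p∣≤length xs (p - y) p-y⊆xs))
  where
  p-y⊆xs : ∀ {x} → x ∈ p - y → x ∈ˡ xs
  p-y⊆xs {x} x∈p-y with p⊆xs (p─q⊆p p _ x∈p-y)
  ... | here ≡.refl  = contradiction x∈p-y (x∉p-x p x)
  ... | there x∈xs = x∈xs

-- Related elements cannot share a partner in `Q`, so deleting the partner of the first element
-- leaves those of all the others. It serves both for centres in covering balls and, with equality
-- as `_∼_`, for cardinalities.
pigeonhole : ∀ {a r s} {A : Set a} {n} {_#_ : Rel A r} {_∼_ : A → Fin n → Set s} →
  (∀ {x y q} → x # y → x ∼ q → ¬ (y ∼ q)) →
  ∀ (Q : Subset n) {xs} → AllPairs _#_ xs → All (λ x → ∃[ q ] q ∈ Q × x ∼ q) xs →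
  length xs ℕ.≤ ∣ Q ∣
pigeonhole sep Q []            []                     = z≤n
pigeonhole {_∼_ = _∼_} sep Q {x ∷ xs} (x#xs ∷ apart) ((q , q∈Q , x∼q) ∷ covered) =
  ℕ.≤-trans (s≤s (pigeonhole sep (Q - q) apart (All.zipWith avoid (x#xs , covered)))) (x∈p⇒∣p-x∣<∣p∣ q∈Q)
  where
  avoid : ∀ {y} → _ × (∃[ r ] r ∈ Q × y ∼ r) → ∃[ r ] r ∈ Q - q × y ∼ r
  avoid (x#y , r , r∈Q , y∼r) =
    r , x∈p∧x≢y⇒x∈p-y r∈Q (λ { ≡.refl → sep x#y x∼q y∼r }) , y∼r

unique⇒length≤ : ∀ {n} (p : Subset n) {xs} → Unique xs → (∀ {x} → x ∈ˡ xs → x ∈ p) → length xs ℕ.≤ ∣ p ∣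
unique⇒length≤ p xs! xs⊆p =
  pigeonhole {_∼_ = _≡_} (λ { x≢y ≡.refl ≡.refl → x≢y ≡.refl }) p xs!
    (All.tabulate (λ x∈xs → _ , xs⊆p x∈xs , ≡.refl))

unique⇒length≤n : ∀ {n} {xs : List (Fin n)} → Unique xs → length xs ℕ.≤ n
unique⇒length≤n {n} {xs} xs! = ≡.subst (length xs ℕ.≤_) (∣⊤∣≡n n) (unique⇒length≤ ⊤ xs! (λ _ → ∈⊤))

∣p∣≡length : ∀ {n} (p : Subset n) {xs} → Unique xs →
  (∀ {x} → x ∈ˡ xs → x ∈ p) → (∀ {x} → x ∈ p → x ∈ˡ xs) → ∣ p ∣ ≡ length xs
∣p∣≡length p xs! xs⊆p p⊆xs = ℕ.≤-antisym (∣p∣≤length _ p p⊆xs) (unique⇒length≤ p xs! xs⊆p)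

subsetOfSize : ∀ {n} (p : Subset n) q → q ℕ.≤ ∣ p ∣ → Σ[ S ∈ Subset n ] S ⊆ p × ∣ S ∣ ≡ q
subsetOfSize []            zero    _         = [] , (λ ()) , ≡.refl
subsetOfSize (outside ∷ p) q       q≤        =
  let S , S⊆p , ∣S∣≡q = subsetOfSize p q q≤ in outside ∷ S , out⊆ S⊆p , ∣S∣≡q
subsetOfSize (inside ∷ p)  zero    _         =
  let S , S⊆p , ∣S∣≡q = subsetOfSize p zero z≤n in outside ∷ S , out⊆ S⊆p , ∣S∣≡q
subsetOfSize (inside ∷ p)  (suc q) (s≤s q≤)  =
  let S , S⊆p , ∣S∣≡q = subsetOfSize p q q≤ in inside ∷ S , s⊆s S⊆p , ≡.cong suc ∣S∣≡q

pairwise : ∀ {a r} {A : Set a} {R : Rel A r} → Symmetric R → ∀ {xs} → AllPairs R xs →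
  ∀ {x y} → x ∈ˡ xs → y ∈ˡ xs → x ≢ y → R x y
pairwise sym-R (Rx ∷ Rxs) (here ≡.refl) (here ≡.refl) x≢y = contradiction ≡.refl x≢y
pairwise sym-R (Rx ∷ Rxs) (here ≡.refl) (there y∈)  _   = All.lookup Rx y∈
pairwise sym-R (Rx ∷ Rxs) (there x∈)  (here ≡.refl) _   = sym-R (All.lookup Rx x∈)
pairwise sym-R (Rx ∷ Rxs) (there x∈)  (there y∈)  x≢y = pairwise sym-R Rxs x∈ y∈ x≢y

-- Counting list elements by group

tally : ∀ {a m} {A : Set a} → (A → Fin m) → List A → Fin m → ℕ
tally g xs i = length (filter (λ x → g x Fin.≟ i) xs)

tally-cong : ∀ {a m} {A : Set a} {g : A → Fin m} {xs ys} →
  Pointwise (λ x y → g x ≡ g y) xs ys → ∀ i → tally g xs i ≡ tally g ys i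
tally-cong []                    i = ≡.refl
tally-cong {g = g} {x ∷ _} {y ∷ _} (gx≡gy ∷ rest) i rewrite gx≡gy with does (g y Fin.≟ i)
... | true  = ≡.cong suc (tally-cong rest i)
... | false = tally-cong rest i

private
  sum-tally-singleton : ∀ {a m} {A : Set a} (g : A → Fin m) x → sum (tally g (x ∷ [])) ≡ 1
  sum-tally-singleton g x = ≡.trans (sum-cong-≗ singleton) (sum-δ (g x))
    where
    δ : ∀ {m} → Fin m → Fin m → ℕ
    δ j i = if does (j Fin.≟ i) then 1 else 0
    singleton : ∀ i → tally g (x ∷ []) i ≡ δ (g x) i
    singleton i with does (g x Fin.≟ i)
    ... | true  = ≡.refl
    ... | false = ≡.refl
    sum-δ : ∀ {m} (j : Fin m) → sum (δ j) ≡ 1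
    sum-δ {suc m} zero    = ≡.cong suc (sum-replicate-zero m)
    sum-δ {suc m} (suc j) = sum-δ j

sum-tally : ∀ {a m} {A : Set a} (g : A → Fin m) xs → sum (tally g xs) ≡ length xs
sum-tally {m = m} g []       = sum-replicate-zero m
sum-tally         g (x ∷ xs) = ≡.trans (sum-cong-≗ split)
  (≡.trans (∑-distrib-+ (tally g (x ∷ [])) (tally g xs))
    (≡.cong₂ ℕ._+_ (sum-tally-singleton g x) (sum-tally g xs)))
  where
  split : ∀ i → tally g (x ∷ xs) i ≡ tally g (x ∷ []) i ℕ.+ tally g xs i
  split i with does (g x Fin.≟ i)
  ... | true  = ≡.refl
  ... | false = ≡.refl

-- Ordered fields

module OrderedFieldProperties {c ℓ₁ ℓ₂} (F : OrderedField c ℓ₁ ℓ₂) where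
  open OrderedField F
  open DecTotalOrder decTotalOrder public
    using (poset; total; antisym; ≤-respʳ-≈; ≤-respˡ-≈)
    renaming (refl to ≤-refl; trans to ≤-trans; reflexive to ≤-reflexive)
  open DecTotalOrderProperties decTotalOrder public using (≰⇒>; <⇒≱)
  open SemiringMult semiring using (×-homo-+; ×1-homo-*)
  open SemiringExp semiring public using (^-congˡ)
  open RingProperties ring using (-‿distribʳ-*; -‿involutive)
  open SemiringSolver commutativeSemiring using (solve; con; _:=_; _:+_; _:*_)
  module ≤-Reasoning = PartialOrderReasoning poset
  open ≤-Reasoning

  +-monoʳ-≤ : ∀ z {x y} → x ≤ y → z + x ≤ z + y
  +-monoʳ-≤ z {x} {y} x≤y = begin
    z + x ≈⟨ +-comm z x ⟩
    x + z ≤⟨ +-monoˡ-≤ z x≤y ⟩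
    y + z ≈⟨ +-comm y z ⟩
    z + y ∎

  +-mono-≤ : ∀ {x y u v} → x ≤ y → u ≤ v → x + u ≤ y + v
  +-mono-≤ {y = y} {u} x≤y u≤v = ≤-trans (+-monoˡ-≤ u x≤y) (+-monoʳ-≤ y u≤v)

  +-cancelʳ-≤ : ∀ z {x y} → x + z ≤ y + z → x ≤ y
  +-cancelʳ-≤ z {x} {y} x+z≤y+z = begin
    x             ≈⟨ cancel x ⟨
    x + z + - z   ≤⟨ +-monoˡ-≤ (- z) x+z≤y+z ⟩
    y + z + - z   ≈⟨ cancel y ⟩
    y             ∎
    where
    cancel : ∀ w → w + z + - z ≈ w
    cancel w = trans (+-assoc w z (- z)) (trans (+-congˡ (-‿inverseʳ z)) (+-identityʳ w))

  x≤x+y : ∀ {x y} → 0# ≤ y → x ≤ x + y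
  x≤x+y {x} {y} 0≤y = begin
    x      ≈⟨ +-identityʳ x ⟨
    x + 0# ≤⟨ +-monoʳ-≤ x 0≤y ⟩
    x + y  ∎

  +-nonNegative : ∀ {x y} → 0# ≤ x → 0# ≤ y → 0# ≤ x + y
  +-nonNegative 0≤x 0≤y = ≤-trans 0≤x (x≤x+y 0≤y)

  x≤0⇒0≤-x : ∀ {x} → x ≤ 0# → 0# ≤ - x
  x≤0⇒0≤-x {x} x≤0 = begin
    0#       ≈⟨ -‿inverseʳ x ⟨
    x + - x  ≤⟨ +-monoˡ-≤ (- x) x≤0 ⟩
    0# + - x ≈⟨ +-identityˡ (- x) ⟩
    - x      ∎

  *-monoʳ-≤ : ∀ {x y z} → 0# ≤ z → x ≤ y → z * x ≤ z * y
  *-monoʳ-≤ {x} {y} {z} 0≤z x≤y = +-cancelʳ-≤ (z * - x) (begin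
    z * x + z * - x  ≈⟨ distribˡ z x (- x) ⟨
    z * (x + - x)    ≈⟨ trans (*-congˡ (-‿inverseʳ x)) (zeroʳ z) ⟩
    0#               ≤⟨ *-nonNegative 0≤z 0≤y-x ⟩
    z * (y + - x)    ≈⟨ distribˡ z y (- x) ⟩
    z * y + z * - x  ∎)
    where
    0≤y-x : 0# ≤ y + - x
    0≤y-x = ≤-respˡ-≈ (-‿inverseʳ x) (+-monoˡ-≤ (- x) x≤y)

  *-monoˡ-≤ : ∀ {x y z} → 0# ≤ z → x ≤ y → x * z ≤ y * z
  *-monoˡ-≤ {x} {y} {z} 0≤z x≤y = begin
    x * z ≈⟨ *-comm x z ⟩
    z * x ≤⟨ *-monoʳ-≤ 0≤z x≤y ⟩
    z * y ≈⟨ *-comm z y ⟩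
    y * z ∎

  *-mono-≤ : ∀ {x y u v} → 0# ≤ u → 0# ≤ y → x ≤ y → u ≤ v → x * u ≤ y * v
  *-mono-≤ 0≤u 0≤y x≤y u≤v = ≤-trans (*-monoˡ-≤ 0≤u x≤y) (*-monoʳ-≤ 0≤y u≤v)

  0≤1 : 0# ≤ 1#
  0≤1 with total 0# 1#
  ... | inj₁ 0≤1 = 0≤1
  ... | inj₂ 1≤0 = begin
    0#          ≤⟨ *-nonNegative 0≤-1 0≤-1 ⟩
    - 1# * - 1# ≈⟨ -‿distribʳ-* (- 1#) 1# ⟨
    - (- 1# * 1#) ≈⟨ -‿cong (*-identityʳ (- 1#)) ⟩
    - - 1#      ≈⟨ -‿involutive 1# ⟩
    1#          ∎
    where
    0≤-1 : 0# ≤ - 1#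
    0≤-1 = x≤0⇒0≤-x 1≤0

  1≰0 : ¬ (1# ≤ 0#)
  1≰0 1≤0 = 0≉1 (antisym 0≤1 1≤0)

  0<⇒0≤ : ∀ {x} → 0# < x → 0# ≤ x
  0<⇒0≤ = proj₁

  0<⇒≉0 : ∀ {x} → 0# < x → x ≉ 0#
  0<⇒≉0 (_ , 0≉x) x≈0 = 0≉x (sym x≈0)

  1≤⇒0≤ : ∀ {x} → 1# ≤ x → 0# ≤ x
  1≤⇒0≤ = ≤-trans 0≤1

  1≤⇒0< : ∀ {x} → 1# ≤ x → 0# < x
  1≤⇒0< 1≤x = 1≤⇒0≤ 1≤x , λ 0≈x → 1≰0 (≤-respʳ-≈ (sym 0≈x) 1≤x)

  ⁻¹-nonNegative : ∀ {x} → 0# < x → 0# ≤ x ⁻¹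
  ⁻¹-nonNegative {x} 0<x with total 0# (x ⁻¹)
  ... | inj₁ 0≤x⁻¹ = 0≤x⁻¹
  ... | inj₂ x⁻¹≤0 = ⊥-elim (1≰0 (begin
    1#         ≈⟨ ⁻¹-inverseʳ x (0<⇒≉0 0<x) ⟨
    x * x ⁻¹   ≤⟨ *-monoʳ-≤ (0<⇒0≤ 0<x) x⁻¹≤0 ⟩
    x * 0#     ≈⟨ zeroʳ x ⟩
    0#         ∎))

  [x/y]*y≈x : ∀ {x y} → y ≉ 0# → x / y * y ≈ x
  [x/y]*y≈x {x} {y} y≉0 = trans (*-assoc x (y ⁻¹) y)
    (trans (*-congˡ (trans (*-comm (y ⁻¹) y) (⁻¹-inverseʳ y y≉0))) (*-identityʳ x))

  [x*y]/y≈x : ∀ {x y} → y ≉ 0# → (x * y) / y ≈ x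
  [x*y]/y≈x {x} {y} y≉0 = trans (*-assoc x y (y ⁻¹))
    (trans (*-congˡ (⁻¹-inverseʳ y y≉0)) (*-identityʳ x))

  x≤y*z⇒x/z≤y : ∀ {x y z} → 0# < z → x ≤ y * z → x / z ≤ y
  x≤y*z⇒x/z≤y {x} {y} {z} 0<z x≤yz = begin
    x / z       ≤⟨ *-monoˡ-≤ (⁻¹-nonNegative 0<z) x≤yz ⟩
    (y * z) / z ≈⟨ [x*y]/y≈x (0<⇒≉0 0<z) ⟩
    y           ∎

  x*z≤y⇒x≤y/z : ∀ {x y z} → 0# < z → x * z ≤ y → x ≤ y / z
  x*z≤y⇒x≤y/z {x} {y} {z} 0<z xz≤y = begin
    x           ≈⟨ [x*y]/y≈x (0<⇒≉0 0<z) ⟨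
    (x * z) / z ≤⟨ *-monoˡ-≤ (⁻¹-nonNegative 0<z) xz≤y ⟩
    y / z       ∎

  0</ : ∀ {x y} → 0# < x → 0# < y → 0# < x / y
  0</ {x} {y} 0<x 0<y = *-nonNegative (0<⇒0≤ 0<x) (⁻¹-nonNegative 0<y) , λ 0≈x/y →
    proj₂ 0<x (begin-equality
      0#        ≈⟨ zeroˡ y ⟨
      0# * y    ≈⟨ *-congʳ 0≈x/y ⟩
      x / y * y ≈⟨ [x/y]*y≈x (0<⇒≉0 0<y) ⟩
      x         ∎)

  fromℕ-+ : ∀ a b → fromℕ (a ℕ.+ b) ≈ fromℕ a + fromℕ b
  fromℕ-+ = ×-homo-+ 1#

  fromℕ-* : ∀ a b → fromℕ (a ℕ.* b) ≈ fromℕ a * fromℕ b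
  fromℕ-* = ×1-homo-*

  fromℕ-nonNegative : ∀ a → 0# ≤ fromℕ a
  fromℕ-nonNegative zero    = ≤-refl
  fromℕ-nonNegative (suc a) = +-nonNegative 0≤1 (fromℕ-nonNegative a)

  fromℕ-mono : ∀ {a b} → a ℕ.≤ b → fromℕ a ≤ fromℕ b
  fromℕ-mono {b = b} z≤n = fromℕ-nonNegative b
  fromℕ-mono (s≤s a≤b)   = +-monoʳ-≤ 1# (fromℕ-mono a≤b)

  1≤fromℕ : ∀ {a} → 1 ℕ.≤ a → 1# ≤ fromℕ a
  1≤fromℕ 1≤a = ≤-respˡ-≈ (+-identityʳ 1#) (fromℕ-mono {1} 1≤a)

  1≤*1≤ : ∀ {x y} → 1# ≤ x → 1# ≤ y → 1# ≤ x * y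
  1≤*1≤ 1≤x 1≤y = ≤-respˡ-≈ (*-identityˡ 1#) (*-mono-≤ 0≤1 (1≤⇒0≤ 1≤x) 1≤x 1≤y)

  x≤x*y : ∀ {x y} → 0# ≤ x → 1# ≤ y → x ≤ x * y
  x≤x*y 0≤x 1≤y = ≤-respˡ-≈ (*-identityʳ _) (*-monoʳ-≤ 0≤x 1≤y)

  1≤^ : ∀ {x} n → 1# ≤ x → 1# ≤ x ^ n
  1≤^ zero    1≤x = ≤-refl
  1≤^ (suc n) 1≤x = 1≤*1≤ 1≤x (1≤^ n 1≤x)

  -- Charges the `dim` iterations that compute the power to the power itself. In the induction
  -- `x ^ n` dominates both 1 and n, and one more factor at least doubles it.
  n≤x^n : ∀ {x} n → fromℕ 2 ≤ x → fromℕ n ≤ x ^ n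
  n≤x^n {x} zero    2≤x = 0≤1
  n≤x^n {x} (suc n) 2≤x = begin
    1# + fromℕ n       ≤⟨ +-mono-≤ (1≤^ n 1≤x) (n≤x^n n 2≤x) ⟩
    x ^ n + x ^ n      ≈⟨ solve 1 (λ y → y :+ y := (con 1 :+ (con 1 :+ con 0)) :* y) refl (x ^ n) ⟩
    fromℕ 2 * x ^ n    ≤⟨ *-monoˡ-≤ (1≤⇒0≤ (1≤^ n 1≤x)) 2≤x ⟩
    x * x ^ n          ∎
    where
    1≤x : 1# ≤ x
    1≤x = ≤-trans (1≤fromℕ {2} (s≤s z≤n)) 2≤x

-- Fair sets and their diversity

length-filter-¬ : ∀ {a p} {A : Set a} {P : Pred A p} (P? : Decidable P) xs →
  length xs ≡ length (filter P? xs) ℕ.+ length (filter (¬? ∘ P?) xs)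
length-filter-¬ P? []       = ≡.refl
length-filter-¬ P? (x ∷ xs) with does (P? x)
... | true  = ≡.cong suc (length-filter-¬ P? xs)
... | false = ≡.trans (≡.cong suc (length-filter-¬ P? xs)) (≡.sym (ℕ.+-suc _ _))

unique⇒allPairs : ∀ {a r} {A : Set a} {R : Rel A r} {xs} → Unique xs →
  (∀ {x y} → x ∈ˡ xs → y ∈ˡ xs → x ≢ y → R x y) → AllPairs R xs
unique⇒allPairs []           _ = []
unique⇒allPairs (x∉ ∷ xs!) R-xs =
  All.tabulate (λ y∈ → R-xs (here ≡.refl) (there y∈) (All.lookup x∉ y∈)) ∷
  unique⇒allPairs xs! (λ x∈ y∈ → R-xs (there x∈) (there y∈))

module FairSets {c ℓ₁ ℓ₂} (F : OrderedField c ℓ₁ ℓ₂) (I : Diversification.Instance F) where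
  open OrderedField F
  open OrderedFieldProperties F
  open Diversification F
  open Instance I
  module Ext = Extrema totalOrder⁺
  open IsGeneralMetric isMetric public
    using (nonNegative; triangle; ≈⇒0; 0⇒≈) renaming (sym to d-sym)
  open DecMembership (Fin._≟_ {n}) using () renaming (_∈?_ to _∈ˡ?_)

  ∈-class⁻ : ∀ {x i} → x ∈ class group i → group x ≡ i
  ∈-class⁻ {i = i} = ∈-⟦⟧⁻ (λ x → group x Fin.≟ i)

  ∈-class⁺ : ∀ {x i} → group x ≡ i → x ∈ class group i
  ∈-class⁺ {i = i} = ∈-⟦⟧⁺ (λ x → group x Fin.≟ i)

  members : Subset n → List (Fin n)
  members S = filter (_∈? S) (allFin n)

  members! : ∀ S → Unique (members S)
  members! S = filter⁺ (_∈? S) (allFin⁺ n)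

  ∈-members⁻ : ∀ {S x} → x ∈ˡ members S → x ∈ S
  ∈-members⁻ {S} = proj₂ ∘ ∈-filter⁻ (_∈? S) {xs = allFin n}

  ∈-members⁺ : ∀ {S x} → x ∈ S → x ∈ˡ members S
  ∈-members⁺ {S} {x} = ∈-filter⁺ (_∈? S) (∈-allFin x)

  -- Any duplicate-free enumeration is allowed, so that this applies both to `members S` and to a
  -- list of replacements. Fairness is thereby carried along a pointwise, group-preserving exchange
  -- of lists.
  ∣S∩class∣≡tally : ∀ S {xs} → Unique xs → (∀ {x} → x ∈ˡ xs → x ∈ S) → (∀ {x} → x ∈ S → x ∈ˡ xs) →
    ∀ i → ∣ S ∩ class group i ∣ ≡ tally group xs i
  ∣S∩class∣≡tally S {xs} xs! xs⊆S S⊆xs i = ∣p∣≡length (S ∩ class group i) (filter⁺ group≟i xs!)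
    (λ x∈ → let x∈xs , gx≡i = ∈-filter⁻ group≟i {xs = xs} x∈ in x∈p∩q⁺ (xs⊆S x∈xs , ∈-class⁺ gx≡i))
    (λ x∈ → let x∈S , x∈class = x∈p∩q⁻ S _ x∈ in ∈-filter⁺ group≟i (S⊆xs x∈S) (∈-class⁻ x∈class))
    where
    group≟i : Decidable (λ x → group x ≡ i)
    group≟i x = group x Fin.≟ i

  fair⇒∣members∣≡k : ∀ {S} → Fair S → length (members S) ≡ k
  fair⇒∣members∣≡k {S} fair = ≡.trans (≡.sym (sum-tally group (members S)))
    (sum-cong-≗ (λ i → ≡.trans (≡.sym (∣S∩class∣≡tally S (members! S) ∈-members⁻ ∈-members⁺ i)) (fair i)))

  -- Since the groups are disjoint, a point need only be looked up in the set chosen for its own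
  -- group.
  fairSet : Σ[ S ∈ Subset n ] Fair S
  fairSet = S , λ i → ≡.trans (≡.cong ∣_∣ (S∩class i)) (∣chosen∣ i)
    where
    chosen : Fin m → Subset n
    chosen i = proj₁ (subsetOfSize (class group i) (quota i) (quota≤ i))
    chosen⊆ : ∀ i → chosen i ⊆ class group i
    chosen⊆ i = proj₁ (proj₂ (subsetOfSize (class group i) (quota i) (quota≤ i)))
    ∣chosen∣ : ∀ i → ∣ chosen i ∣ ≡ quota i
    ∣chosen∣ i = proj₂ (proj₂ (subsetOfSize (class group i) (quota i) (quota≤ i)))
    ∈chosen? : Decidable (λ x → x ∈ chosen (group x))
    ∈chosen? x = x ∈? chosen (group x)
    S : Subset n
    S = ⟦ ∈chosen? ⟧
    S∩class : ∀ i → S ∩ class group i ≡ chosen i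
    S∩class i = ⊆-antisym
      (λ {x} x∈ → let x∈S , x∈class = x∈p∩q⁻ S _ x∈ in
        ≡.subst (λ j → x ∈ chosen j) (∈-class⁻ x∈class) (∈-⟦⟧⁻ ∈chosen? x∈S))
      (λ {x} x∈ → let gx≡i = ∈-class⁻ (chosen⊆ i x∈) in
        x∈p∩q⁺ (∈-⟦⟧⁺ ∈chosen? (≡.subst (λ j → x ∈ chosen j) (≡.sym gx≡i) x∈) , chosen⊆ i x∈))

  Separated : Carrier → Subset n → Set _
  Separated R S = ∀ {u v} → u ∈ S → v ∈ S → u ≢ v → R ≤ d u v

  distinct? : ∀ S (p : Fin n × Fin n) → Dec (proj₁ p ∈ S × proj₂ p ∈ S × proj₁ p ≢ proj₂ p)
  distinct? S (u , v) = u ∈? S ×-dec v ∈? S ×-dec ¬? (u Fin.≟ v)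

  pairs : List (Fin n × Fin n)
  pairs = cartesianProduct (allFin n) (allFin n)

  ≤⁺-div : ∀ {x S} → (∀ {u v} → u ∈ S → v ∈ S → u ≢ v → x ≤⁺ [ d u v ]) → x ≤⁺ div S
  ≤⁺-div {S = S} x≤ = Ext.v≤min⁺ (_ ≤⊤⁺) (All.map⁺ (All.tabulate (λ p∈ →
    let u∈S , v∈S , u≢v = proj₂ (∈-filter⁻ (distinct? S) {xs = pairs} p∈) in x≤ u∈S v∈S u≢v)))

  div-≤⁺ : ∀ {S u v} → u ∈ S → v ∈ S → u ≢ v → div S ≤⁺ [ d u v ]
  div-≤⁺ {S} {u} {v} u∈S v∈S u≢v = All.lookup (Ext.min≤xs ⊤⁺ _) (∈-map⁺ (λ (u , v) → [ d u v ])
    (∈-filter⁺ (distinct? S) (∈-cartesianProduct⁺ (∈-allFin u) (∈-allFin v)) (u∈S , v∈S , u≢v)))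

  -- In the attained case `u ≢ v` is kept because it makes the diversity positive and hence usable
  -- as the scale `R`.
  div-selective : ∀ S → div S ≡ ⊤⁺ ⊎ (∃[ u ] ∃[ v ] u ≢ v × div S ≡ [ d u v ])
  div-selective S with Ext.argmin-sel id ⊤⁺ (map (λ (u , v) → [ d u v ]) (distinctPairs S))
  ... | inj₁ div≡⊤ = inj₁ div≡⊤
  ... | inj₂ div∈  =
    let (u , v) , p∈ , div≡ = ∈-map⁻ (λ (u , v) → [ d u v ]) div∈
        _ , _ , u≢v = proj₂ (∈-filter⁻ (distinct? S) {xs = pairs} p∈)
    in inj₂ (u , v , u≢v , div≡)

  -- If the maximum falls back on its seed `0#`, any fair set will do, as `0#` is below all
  -- distances.
  optimal : Σ[ S ∈ Subset n ] Fair S × ℓ* ≤⁺ div S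
  optimal with Ext.argmax-sel id [ 0# ] (map div (filter fair? (allSubsets n)))
  ... | inj₁ ℓ*≡0 = let S , fair = fairSet in
    S , fair , ≡.subst (_≤⁺ div S) (≡.sym ℓ*≡0) (≤⁺-div (λ _ _ _ → [ nonNegative ]))
  ... | inj₂ ℓ*∈ = let S , S∈ , ℓ*≡ = ∈-map⁻ div ℓ*∈ in
    S , proj₂ (∈-filter⁻ fair? {xs = allSubsets n} S∈) , ≡.subst (_≤⁺ div S) (≡.sym ℓ*≡) (≤⁺-refl (div S))
    where
    ≤⁺-refl : ∀ x → x ≤⁺ x
    ≤⁺-refl ⊤⁺    = ⊤⁺ ≤⊤⁺
    ≤⁺-refl [ x ] = [ ≤-refl ]

  0<d : ∀ {u v} → u ≢ v → 0# < d u v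
  0<d u≢v = nonNegative , λ 0≈d → u≢v (0⇒≈ (sym 0≈d))

-- Nets in every group form a coreset

module Accuracy {c ℓ₁ ℓ₂} (F : OrderedField c ℓ₁ ℓ₂)
  {ε : OrderedField.Carrier F} (0<ε : OrderedField._<_ F (OrderedField.0# F) ε)
  (ε≤1 : OrderedField._≤_ F ε (OrderedField.1# F)) where
  open OrderedField F
  open OrderedFieldProperties F
  open SemiringSolver commutativeSemiring using (solve; con; Polynomial; _:=_; _:+_; _:*_)
  open ≤-Reasoning

  private
    -- Unary, so that for a closed argument the polynomial evaluates definitionally to the sum of
    -- ones that `fromℕ` unfolds to.
    numeral : ∀ {n} → ℕ → Polynomial n
    numeral zero    = con 0
    numeral (suc a) = con 1 :+ numeral a

  q : Carrier
  q = fromℕ 8 / ε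

  q*ε≈8 : q * ε ≈ fromℕ 8
  q*ε≈8 = [x/y]*y≈x (0<⇒≉0 0<ε)

  8≤q : fromℕ 8 ≤ q
  8≤q = x*z≤y⇒x≤y/z 0<ε (begin
    fromℕ 8 * ε  ≤⟨ *-monoʳ-≤ (fromℕ-nonNegative 8) ε≤1 ⟩
    fromℕ 8 * 1# ≈⟨ *-identityʳ (fromℕ 8) ⟩
    fromℕ 8      ∎)

  fromℕ≤q : ∀ {a} → a ℕ.≤ 8 → fromℕ a ≤ q
  fromℕ≤q a≤8 = ≤-trans (fromℕ-mono a≤8) 8≤q

  1≤q : 1# ≤ q
  1≤q = ≤-trans (1≤fromℕ {8} (s≤s z≤n)) 8≤q

  1≤1+ε : 1# ≤ 1# + ε
  1≤1+ε = x≤x+y (0<⇒0≤ 0<ε)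

  0<1+ε : 0# < 1# + ε
  0<1+ε = 1≤⇒0< 1≤1+ε

  module Scale {R : Carrier} (0<R : 0# < R) where

    h : Carrier
    h = R / q

    -- Both the distance by which a point may move to a centre and the separation of the centres
    -- when it cannot.
    w : Carrier
    w = h + h

    0<h : 0# < h
    0<h = 0</ 0<R (1≤⇒0< 1≤q)

    h*q≈R : h * q ≈ R
    h*q≈R = [x/y]*y≈x (0<⇒≉0 (1≤⇒0< 1≤q))

    R/h≈q : R / h ≈ q
    R/h≈q = begin-equality
      R / h       ≈⟨ *-congʳ (trans (sym h*q≈R) (*-comm h q)) ⟩
      (q * h) / h ≈⟨ [x*y]/y≈x (0<⇒≉0 0<h) ⟩
      q           ∎

    h≤R/2 : h ≤ R / fromℕ 2
    h≤R/2 = x*z≤y⇒x≤y/z (1≤⇒0< (1≤fromℕ {2} (s≤s z≤n))) (begin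
      h * fromℕ 2 ≤⟨ *-monoʳ-≤ (0<⇒0≤ 0<h) (fromℕ≤q (s≤s (s≤s z≤n))) ⟩
      h * q       ≈⟨ h*q≈R ⟩
      R           ∎)

    R*ε≈h*8 : R * ε ≈ h * fromℕ 8
    R*ε≈h*8 = begin-equality
      R * ε       ≈⟨ *-congʳ h*q≈R ⟨
      h * q * ε   ≈⟨ *-assoc h q ε ⟩
      h * (q * ε) ≈⟨ *-congˡ q*ε≈8 ⟩
      h * fromℕ 8 ∎

    -- (R - 4h)(1 + ε) ≥ R, as 4h + 4hε ≤ 8h = Rε.
    R≤δ+2w⇒R/[1+ε]≤δ : ∀ {δ} → R ≤ δ + (w + w) → R / (1# + ε) ≤ δ
    R≤δ+2w⇒R/[1+ε]≤δ {δ} R≤δ+2w = x≤y*z⇒x/z≤y 0<1+ε (+-cancelʳ-≤ (R * ε) (begin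
      R + R * ε
        ≈⟨ solve 2 (λ R ε → R :+ R :* ε := R :* (con 1 :+ ε)) refl R ε ⟩
      R * (1# + ε)
        ≤⟨ *-monoˡ-≤ (0<⇒0≤ 0<1+ε) R≤δ+2w ⟩
      (δ + (w + w)) * (1# + ε)
        ≈⟨ solve 3 (λ δ w ε → (δ :+ (w :+ w)) :* (con 1 :+ ε) :=
              δ :* (con 1 :+ ε) :+ (w :+ w :+ (w :+ w) :* ε)) refl δ w ε ⟩
      δ * (1# + ε) + (w + w + (w + w) * ε)
        ≤⟨ +-monoʳ-≤ _ (+-monoʳ-≤ (w + w) (*-monoʳ-≤ 0≤2w ε≤1)) ⟩
      δ * (1# + ε) + (w + w + (w + w) * 1#)
        ≈⟨ +-congˡ (solve 1 (λ h → let w = h :+ h in w :+ w :+ (w :+ w) :* con 1 := h :* numeral 8) refl h) ⟩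
      δ * (1# + ε) + h * fromℕ 8
        ≈⟨ +-congˡ R*ε≈h*8 ⟨
      δ * (1# + ε) + R * ε ∎))
      where
      0≤w : 0# ≤ w
      0≤w = +-nonNegative (0<⇒0≤ 0<h) (0<⇒0≤ 0<h)
      0≤2w : 0# ≤ w + w
      0≤2w = +-nonNegative 0≤w 0≤w

-- Packing of centres and exchange of points

module Coreset {c ℓ₁ ℓ₂} (F : OrderedField c ℓ₁ ℓ₂)
  {ε : OrderedField.Carrier F} (0<ε : OrderedField._<_ F (OrderedField.0# F) ε)
  (ε≤1 : OrderedField._≤_ F ε (OrderedField.1# F))
  (I : Diversification.Instance F) (dim : ℕ)
  (doubling : Diversification.Instance.Doubling I dim) where
  open OrderedField F
  open Diversification F
  open Instance I
  open OrderedFieldProperties F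
  open Accuracy F 0<ε ε≤1
  open FairSets F I
  open DecMembership (Fin._≟_ {n}) using () renaming (_∈?_ to _∈ˡ?_)
  open ≤-Reasoning

  D : Carrier
  D = q ^ dim

  1≤D : 1# ≤ D
  1≤D = 1≤^ dim 1≤q

  -- greedy: each centre was farthest from the earlier ones when it was chosen, so
  -- a point far from all centres forces the centres to be as far from each other.
  -- exhausted: there are more than D (k - 1) centres, or more centres than points.
  record Net (T : Subset n) (u : Fin n) : Set (c ⊔ ℓ₂) where
    field
      centres   : List (Fin n)
      sameGroup : All (λ t → group t ≡ group u) centres
      selected  : All (_∈ T) centres
      greedy    : ∀ {r} → All (λ t → r ≤ d u t) centres → AllPairs (λ s t → r ≤ d s t) centres
      exhausted : ¬ (fromℕ (suc (length centres)) ≤ D * fromℕ k) ⊎ n ℕ.< length centres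

  module AtScale {R : Carrier} (0<R : 0# < R) where
    open Scale 0<R

    Apart : Rel (Fin n) ℓ₂
    Apart s t = w ≤ d s t

    -- Balls of radius h = w / 2 contain at most one point of a w-separated list.
    ball-packing : ∀ b {xs} → AllPairs Apart xs → All (λ t → d b t < R) xs → fromℕ (length xs) ≤ D
    ball-packing b {xs} apart near with doubling b R h 0<h h≤R/2
    ... | Q , ∣Q∣≤ , covers = begin
      fromℕ (length xs) ≤⟨ fromℕ-mono (pigeonhole separate Q apart (All.map covers near)) ⟩
      fromℕ ∣ Q ∣       ≤⟨ ∣Q∣≤ ⟩
      (R / h) ^ dim     ≈⟨ ^-congˡ dim R/h≈q ⟩
      D                 ∎
      where
      separate : ∀ {s t p} → Apart s t → d p s < h → ¬ (d p t < h)
      separate {s} {t} {p} w≤dst dps<h dpt<h = <⇒≱ dpt<h (+-cancelʳ-≤ h (begin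
        h + h         ≤⟨ w≤dst ⟩
        d s t         ≤⟨ triangle _ _ _ ⟩
        d s p + d p t ≈⟨ trans (+-congʳ (d-sym _ _)) (+-comm _ _) ⟩
        d p t + d p s ≤⟨ +-monoʳ-≤ _ (proj₁ dps<h) ⟩
        d p t + h     ∎))

    -- Each centre is charged to the first point of `bs` at distance less than `R`. The centres
    -- charged to one point lie in a single ball, so `ball-packing` allows at most D of them.
    blocked-packing : ∀ bs {xs} → AllPairs Apart xs → All (λ t → Any (λ b → ¬ (R ≤ d b t)) bs) xs →
      fromℕ (length xs) ≤ D * fromℕ (length bs)
    blocked-packing []       {[]}    _     _        = ≤-reflexive (sym (zeroʳ D))
    blocked-packing []       {_ ∷ _} _     (() ∷ _)
    blocked-packing (b ∷ bs) {xs}    apart blocked  = begin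
      fromℕ (length xs)
        ≡⟨ ≡.cong fromℕ (length-filter-¬ blocks? xs) ⟩
      fromℕ (length (filter blocks? xs) ℕ.+ length (filter (¬? ∘ blocks?) xs))
        ≈⟨ fromℕ-+ (length (filter blocks? xs)) _ ⟩
      fromℕ (length (filter blocks? xs)) + fromℕ (length (filter (¬? ∘ blocks?) xs))
        ≤⟨ +-mono-≤ (ball-packing b (AllPairs.filter⁺ blocks? apart) (All.map ≰⇒> (All.all-filter blocks? xs)))
                    (blocked-packing bs (AllPairs.filter⁺ (¬? ∘ blocks?) apart)
                      (All.zipWith later (All.all-filter (¬? ∘ blocks?) xs ,
                                          All.filter⁺ (¬? ∘ blocks?) blocked))) ⟩
      D + D * fromℕ (length bs)
        ≈⟨ +-congʳ (*-identityʳ D) ⟨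
      D * 1# + D * fromℕ (length bs)
        ≈⟨ distribˡ D 1# _ ⟨
      D * (1# + fromℕ (length bs)) ∎
      where
      blocks? : Decidable (λ t → ¬ (R ≤ d b t))
      blocks? t = ¬? (R ≤? d b t)
      later : ∀ {t} → ¬ ¬ (R ≤ d b t) × Any (λ b → ¬ (R ≤ d b t)) (b ∷ bs) → Any (λ b → ¬ (R ≤ d b t)) bs
      later (¬blocks , here  blocks)  = contradiction blocks ¬blocks
      later (¬blocks , there blocked) = blocked

    module _ {T : Subset n} (net : ∀ u → Net T u) where

      -- `bs` stands for the current positions of the other points. If neither a near centre nor one
      -- far from all of `bs` exists, the centres are w-separated and all blocked, which either
      -- clause of `exhausted` excludes.
      replace : ∀ u bs → suc (length bs) ℕ.≤ k →
        ∃[ p ] group p ≡ group u × p ∈ T × (d u p ≤ w ⊎ All (λ b → R ≤ d b p) bs)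
      replace u bs ∣bs∣<k with Any.any? (λ t → d u t ≤? w) centres
        where
        open Net (net u)
      ... | yes near = let p , p∈ , dup≤w = find near in
        p , All.lookup sameGroup p∈ , All.lookup selected p∈ , inj₁ dup≤w
        where
        open Net (net u)
      ... | no ¬near with Any.any? (λ t → All.all? (λ b → R ≤? d b t) bs) (Net.centres (net u))
      ...   | yes free = let p , p∈ , far = find free in
        p , All.lookup sameGroup p∈ , All.lookup selected p∈ , inj₂ far
        where
        open Net (net u)
      ...   | no ¬free = ⊥-elim ([ short , long ]′ exhausted)
        where
        open Net (net u)
        apart : AllPairs Apart centres
        apart = greedy (All.map (proj₁ ∘ ≰⇒>) (All.¬Any⇒All¬ _ ¬near))
        -- `exhausted` only says that one more centre would exceed D k. That extra 1 is paid by the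
        -- share D of the point being replaced, as 1 ≤ D; the blocked centres use the shares of the
        -- others.
        short : ¬ ¬ (fromℕ (suc (length centres)) ≤ D * fromℕ k)
        short ¬≤ = ¬≤ (begin
          1# + fromℕ (length centres)
            ≤⟨ +-mono-≤ 1≤D (blocked-packing bs apart
                 (All.map (All.¬All⇒Any¬ (λ b → R ≤? d b _) bs) (All.¬Any⇒All¬ _ ¬free))) ⟩
          D + D * fromℕ (length bs)
            ≈⟨ +-congʳ (*-identityʳ D) ⟨
          D * 1# + D * fromℕ (length bs)
            ≈⟨ distribˡ D 1# _ ⟨
          D * fromℕ (suc (length bs))
            ≤⟨ *-monoʳ-≤ (1≤⇒0≤ 1≤D) (fromℕ-mono ∣bs∣<k) ⟩
          D * fromℕ k ∎)
        apart⇒≢ : ∀ {s t} → Apart s t → s ≢ t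
        apart⇒≢ w≤dss ≡.refl = <⇒≱ 0<h (≤-trans (x≤x+y (0<⇒0≤ 0<h)) (≤-respʳ-≈ (≈⇒0 ≡.refl) w≤dss))
        -- Separated centres are distinct, so the cap on the rounds cannot have been reached while
        -- no centre is near.
        long : ¬ (n ℕ.< length centres)
        long n<∣centres∣ = ℕ.<⇒≱ n<∣centres∣ (unique⇒length≤n (AllPairs.map apart⇒≢ apart))

      -- The points of U are replaced one at a time; P holds the replacements
      -- already made, so that each distance loses w at most twice.
      exchange : ∀ P U → length P ℕ.+ length U ℕ.≤ k →
        All (λ u → All (λ p → R ≤ d p u + w) P) U → AllPairs (λ u v → R ≤ d u v) U →
        Σ[ V ∈ List (Fin n) ] Pointwise (λ v u → group v ≡ group u) V U × All (_∈ T) V ×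
          All (λ v → All (λ p → R ≤ d p v + (w + w)) P) V × AllPairs (λ u v → R ≤ d u v + (w + w)) V
      exchange P []      _      _         _         = [] , [] , [] , [] , []
      exchange P (u ∷ U) ∣PU∣≤k (Pu ∷ PU) (uU ∷ UU) = extend (replace u (P ++ U) ∣P++U∣<k)
        where
        -- The obstacles are the replacements already made together with the points still waiting,
        -- at most k - 1 in all.
        ∣P++U∣<k : suc (length (P ++ U)) ℕ.≤ k
        ∣P++U∣<k = ≡.subst (ℕ._≤ k) (≡.trans (ℕ.+-suc _ _) (≡.cong suc (≡.sym (length-++ P)))) ∣PU∣≤k
        0≤w : 0# ≤ w
        0≤w = +-nonNegative (0<⇒0≤ 0<h) (0<⇒0≤ 0<h)
        extend : (∃[ p ] group p ≡ group u × p ∈ T × (d u p ≤ w ⊎ All (λ b → R ≤ d b p) (P ++ U))) → _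
        extend (p , group≡ , p∈T , choice) =
          let V , V∼U , V⊆T , PV , VV = exchange (p ∷ P) U (≡.subst (ℕ._≤ k) (ℕ.+-suc _ _) ∣PU∣≤k)
                                          (All.zipWith (λ (pv , Pv) → pv ∷ Pv) (pU choice , PU)) UU
          in p ∷ V , group≡ ∷ V∼U , p∈T ∷ V⊆T , Pp choice ∷ All.map All.tail PV , All.map All.head PV ∷ VV
          where
          -- A near `p` inherits the distances of `u` up to `w`: the first loss against a waiting
          -- point, and in `Pp` the second against an earlier replacement. A far `p` inherits
          -- nothing and starts afresh at distance `R` from both kinds.
          pU : d u p ≤ w ⊎ All (λ b → R ≤ d b p) (P ++ U) → All (λ v → R ≤ d p v + w) U
          pU (inj₁ dup≤w) = All.map (λ {v} R≤duv → begin
            R             ≤⟨ R≤duv ⟩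
            d u v         ≤⟨ triangle _ _ _ ⟩
            d u p + d p v ≤⟨ +-monoˡ-≤ _ dup≤w ⟩
            w + d p v     ≈⟨ +-comm w _ ⟩
            d p v + w     ∎) uU
          pU (inj₂ far) = All.map (λ {v} R≤dvp → begin
            R         ≤⟨ R≤dvp ⟩
            d v p     ≈⟨ d-sym _ _ ⟩
            d p v     ≤⟨ x≤x+y 0≤w ⟩
            d p v + w ∎) (All.++⁻ʳ P far)
          Pp : d u p ≤ w ⊎ All (λ b → R ≤ d b p) (P ++ U) → All (λ v → R ≤ d v p + (w + w)) P
          Pp (inj₁ dup≤w) = All.map (λ {v} R≤ → begin
            R                   ≤⟨ R≤ ⟩
            d v u + w           ≤⟨ +-monoˡ-≤ w (triangle _ _ _) ⟩
            d v p + d p u + w   ≈⟨ +-congʳ (+-congˡ (d-sym _ _)) ⟩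
            d v p + d u p + w   ≤⟨ +-monoˡ-≤ w (+-monoʳ-≤ _ dup≤w) ⟩
            d v p + w + w       ≈⟨ +-assoc _ w w ⟩
            d v p + (w + w)     ∎) Pu
          Pp (inj₂ far) = All.map (λ R≤dvp → ≤-trans R≤dvp (x≤x+y (+-nonNegative 0≤w 0≤w))) (All.++⁻ˡ P far)

      -- The quotient R / (1 + ε) is positive, so the replacements are distinct. Only for this
      -- reason do the group counts of the list `V` become cardinalities of a set.
      separatedFairSubset : ∀ {S} → Fair S → Separated R S →
        Σ[ T′ ∈ Subset n ] T′ ⊆ T × Fair T′ × Separated (R / (1# + ε)) T′
      separatedFairSubset {S} fair sep
        with exchange [] (members S) (ℕ.≤-reflexive (fair⇒∣members∣≡k fair)) (All.universal (λ _ → []) _)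
               (unique⇒allPairs (members! S) (λ u∈ v∈ → sep (∈-members⁻ u∈) (∈-members⁻ v∈)))
      ... | V , V∼S , V⊆T , _ , VV = T′ , (λ x∈ → All.lookup V⊆T (∈V x∈)) , fair′ ,
              λ u∈ v∈ → pairwise (λ R≤ → ≤-respʳ-≈ (d-sym _ _) R≤) separated (∈V u∈) (∈V v∈)
        where
        separated : AllPairs (λ u v → R / (1# + ε) ≤ d u v) V
        separated = AllPairs.map R≤δ+2w⇒R/[1+ε]≤δ VV
        V! : Unique V
        V! = AllPairs.map (λ { R/α≤duu ≡.refl → <⇒≱ (0</ 0<R 0<1+ε) (≤-respʳ-≈ (≈⇒0 ≡.refl) R/α≤duu) })
               separated
        T′ : Subset n
        T′ = ⟦ (_∈ˡ? V) ⟧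
        ∈V : ∀ {x} → x ∈ T′ → x ∈ˡ V
        ∈V = ∈-⟦⟧⁻ (_∈ˡ? V)
        fair′ : Fair T′
        fair′ i = ≡.trans (∣S∩class∣≡tally T′ V! (∈-⟦⟧⁺ (_∈ˡ? V)) ∈V i)
          (≡.trans (tally-cong V∼S i)
          (≡.trans (≡.sym (∣S∩class∣≡tally S (members! S) ∈-members⁻ ∈-members⁺ i)) (fair i)))

  -- `Net` mentions no scale, so `R` can be taken to be the diversity of an optimal set, which the
  -- program never computes.
  isCoreset : ∀ {T} → (∀ u → Net T u) → IsCoreset (1# + ε) T
  isCoreset {T} net with optimal
  ... | S , fair , ℓ*≤div with div-selective S
  ... | inj₂ (u , v , u≢v , div≡) =
    let T′ , T′⊆T , fair′ , sep = AtScale.separatedFairSubset (0<d u≢v) net fair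
          (λ u∈ v∈ u≢v → [≤]-injective _ (≡.subst (_≤⁺ _) div≡ (div-≤⁺ u∈ v∈ u≢v)))
    in T′ , T′⊆T , fair′ , ≤⁺-div (λ u∈ v∈ u≢v → below (≡.subst (ℓ* ≤⁺_) div≡ ℓ*≤div) (sep u∈ v∈ u≢v))
    where
    below : ∀ {x r s} → x ≤⁺ [ r ] → r / (1# + ε) ≤ s → map⁺ (_/ (1# + ε)) x ≤⁺ [ s ]
    below [ x≤r ] r/α≤s = [ ≤-trans (*-monoˡ-≤ (⁻¹-nonNegative 0<1+ε) x≤r) r/α≤s ]
  -- S has at most one point; a scale beyond all distances keeps it so.
  ... | inj₁ div≡⊤ =
    let T′ , T′⊆T , fair′ , sep = AtScale.separatedFairSubset 0<R net fair
          (λ u∈ v∈ u≢v → contradiction (≡.subst (_≤⁺ _) div≡⊤ (div-≤⁺ u∈ v∈ u≢v)) (λ ()))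
    in T′ , T′⊆T , fair′ , ≤⁺-div (λ u∈ v∈ u≢v → contradiction (sep u∈ v∈ u≢v) (R/α≰d _ _))
    where
    open Extrema (DecTotalOrder.totalOrder decTotalOrder) using (max; ⊥≤max; xs≤max)
    distances : List Carrier
    distances = cartesianProductWith d (allFin n) (allFin n)
    B : Carrier
    B = max 0# distances
    -- The factor 1 + ε anticipates the loss: R / (1 + ε) is 1 + B, and the 1 puts it strictly above
    -- every distance, even when all of them vanish.
    R : Carrier
    R = (1# + B) * (1# + ε)
    0<R : 0# < R
    0<R = 1≤⇒0< (1≤*1≤ (x≤x+y (⊥≤max 0# distances)) 1≤1+ε)
    R/α≰d : ∀ u v → ¬ (R / (1# + ε) ≤ d u v)
    R/α≰d u v R/α≤d = 1≰0 (+-cancelʳ-≤ B (begin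
      1# + B                         ≈⟨ [x*y]/y≈x (0<⇒≉0 0<1+ε) ⟨
      R / (1# + ε)                   ≤⟨ R/α≤d ⟩
      d u v                          ≤⟨ All.lookup (xs≤max 0# distances)
                                           (∈-cartesianProductWith⁺ d (∈-allFin u) (∈-allFin v)) ⟩
      B                              ≈⟨ +-identityˡ B ⟨
      0# + B                         ∎))

-- The program and its execution

≤ᵇ-true⇒≤ : ∀ {i j} → (i ≤ᵇ j) ≡ true → i ℕ.≤ j
≤ᵇ-true⇒≤ {i} {j} = does≡true⇒ (i ℕ.≤? j)

≤ᵇ-false⇒≰ : ∀ {i j} → (i ≤ᵇ j) ≡ false → ¬ (i ℕ.≤ j)
≤ᵇ-false⇒≰ {i} {j} = does≡false⇒¬ (i ℕ.≤? j)

∧-false : ∀ {a b} → (a ∧ b) ≡ false → a ≡ false ⊎ b ≡ false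
∧-false {false} _ = inj₁ ≡.refl
∧-false {true}  e = inj₂ e

atℕ-toℕ : ∀ {a} {A : Set a} {n} (default : A) (f : Fin n → A) x → atℕ default f (toℕ x) ≡ f x
atℕ-toℕ {n = n} default f x with toℕ x ℕ.<? n
... | yes x<n = ≡.cong f (Fin.fromℕ<-toℕ x x<n)
... | no  x≮n = contradiction (Fin.toℕ<n x) x≮n

prefixSum : (ℕ → ℕ) → ℕ → ℕ
prefixSum f zero    = 0
prefixSum f (suc x) = prefixSum f x ℕ.+ f x

prefixSum-suc : ∀ f x → prefixSum f (suc x) ≡ f 0 ℕ.+ prefixSum (f ∘ suc) x
prefixSum-suc f zero    = ℕ.+-comm 0 (f 0)
prefixSum-suc f (suc x) = ≡.trans (≡.cong (ℕ._+ f (suc x)) (prefixSum-suc f x)) (ℕ.+-assoc (f 0) _ _)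

prefixSum≡foldr : ∀ {m} (f : ℕ → ℕ) (q : Fin m → ℕ) → (∀ i → f (toℕ i) ≡ q i) →
  prefixSum f m ≡ Vector.foldr ℕ._+_ 0 q
prefixSum≡foldr {zero}  f q f≗q = ≡.refl
prefixSum≡foldr {suc m} f q f≗q = ≡.trans (prefixSum-suc f m)
  (≡.cong₂ ℕ._+_ (f≗q zero) (prefixSum≡foldr (f ∘ suc) (q ∘ suc) (f≗q ∘ suc)))

-- nat array 0 holds the characteristic vector of the output and nat array 1 the
-- next centre of each group; real array 0 holds the distance of each point to the
-- centres of its group, and real cell 1 the bound D k on the number of rounds.
bestE : Exp nat → Exp nat
bestE = cell nat 1

xE jE kE : Exp nat
xE = cell nat 2 (lit 0)
jE = cell nat 3 (lit 0)
kE = cell nat 4 (lit 0)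

distE : Exp nat → Exp real
distE = cell real 0

limitE : Exp real
limitE = cell real 1 (lit 0)

forX : Exp nat → Cmd → Cmd
forX e P = while (xE +ₑ lit 1 ≤ₑ e) (P ︔ store nat 2 (lit 0) (xE +ₑ lit 1))

nearE : Exp real
nearE = distance xE (bestE (groupOf xE))

-- Each round selects one centre in every group simultaneously.  In the first round
-- all distances are still 0, so that improve takes any point of the group, and the
-- test on j lets mark overwrite these zeros.
addQuota scaleLimit improve mark round program : Cmd
addQuota   = store nat 4 (lit 0) (kE +ₑ quotaOf xE)
scaleLimit = store real 1 (lit 0) (toReal (lit 8) /ₑ epsilon *ₑ limitE)
improve    = branch (distE (bestE (groupOf xE)) ≤ₑ distE xE) (store nat 1 (groupOf xE) xE) skip
mark       = branch (notₑ (lit 1 ≤ₑ jE andₑ notₑ (nearE ≤ₑ distE xE))) (store real 0 xE nearE) skip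
           ︔ store nat 0 (bestE (groupOf xE)) (lit 1)
round      = store nat 2 (lit 0) (lit 0) ︔ forX #points improve
           ︔ store nat 2 (lit 0) (lit 0) ︔ forX #points mark
           ︔ store nat 3 (lit 0) (jE +ₑ lit 1)
program    = forX #groups addQuota
           ︔ store real 1 (lit 0) (toReal kE)
           ︔ store nat 2 (lit 0) (lit 0) ︔ forX dimension scaleLimit
           -- The first test keeps the number of centres per group at most D k without any rounding.
           -- The second guarantees termination when D k exceeds all naturals; being `≤` and not
           -- `<`, it admits n + 1 rounds, one more than there are points.
           ︔ while (toReal (jE +ₑ lit 1) ≤ₑ limitE andₑ jE ≤ₑ #points) round

module Verification {c ℓ₁ ℓ₂} (F : OrderedField c ℓ₁ ℓ₂)
  (I : Diversification.Instance F) (ε : OrderedField.Carrier F) (dim : ℕ) where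
  open OrderedField F
  open OrderedFieldProperties F
  open Diversification F
  open RealRAM F
  open Instance I
  open Semantics I ε dim

  -- Total-correctness rules with time bounds

  Run : ∀ {p} → Cmd → State → (State → Set p) → ℕ → Set (c ⊔ p)
  Run P s Post b = Σ[ s′ ∈ State ] Σ[ t ∈ ℕ ] (⟨ P , s ⟩⇓⟨ s′ , t ⟩) × Post s′ × t ℕ.≤ b

  run-store : ∀ {p} {Post : State → Set p} {τ a i s} {e : Exp τ} →
    Post (assign s τ a (evalℕ s i) e) → Run (store τ a i e) s Post (1 ℕ.+ costₑ i ℕ.+ costₑ e)
  run-store post = _ , _ , ⇓-assign , post , ℕ.≤-refl

  infixr 5 _run-︔_
  _run-︔_ : ∀ {p q} {Mid : State → Set p} {Post : State → Set q} {P Q s a b} →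
    Run P s Mid a → (∀ {s′} → Mid s′ → Run Q s′ Post b) → Run (P ︔ Q) s Post (a ℕ.+ b)
  (s′ , t , P⇓ , mid , t≤a) run-︔ Q-run =
    let s″ , u , Q⇓ , post , u≤b = Q-run mid in s″ , t ℕ.+ u , ⇓-seq P⇓ Q⇓ , post , ℕ.+-mono-≤ t≤a u≤b

  run-branch-store : ∀ {p} {Post : State → Set p} {b τ a i s} {e : Exp τ} →
    (test s b ≡ true → Post (assign s τ a (evalℕ s i) e)) → (test s b ≡ false → Post s) →
    Run (branch b (store τ a i e) skip) s Post (1 ℕ.+ costₜ b ℕ.+ (1 ℕ.+ costₑ i ℕ.+ costₑ e))
  run-branch-store {b = b} {s = s} yes! no! with test s b in eq
  ... | true  = _ , _ , ⇓-then eq ⇓-assign , yes! ≡.refl , ℕ.≤-refl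
  ... | false = _ , _ , ⇓-else eq ⇓-skip , no! ≡.refl , ℕ.+-monoʳ-≤ (1 ℕ.+ costₜ b) (s≤s z≤n)

  -- `M` serves only for termination. The time is expressed by the actual number `N` of iterations,
  -- since the useful bound on `N` comes from the invariant and lives in the field.
  run-while : ∀ {p} {b P a} (Inv : ℕ → State → Set p) (M : ℕ) →
    (∀ {j s} → Inv j s → test s b ≡ true → j ℕ.< M × Run P s (Inv (suc j)) a) →
    ∀ {s} → Inv 0 s →
    Σ[ N ∈ ℕ ] Run (while b P) s (λ s′ → Inv N s′ × test s′ b ≡ false)
                   (N ℕ.* (1 ℕ.+ costₜ b ℕ.+ a) ℕ.+ (1 ℕ.+ costₜ b))
  run-while {b = b} {P} {a} Inv M step {s} inv₀ =
    let N , s′ , t , ⇓ , post , t≤ = go M 0 (ℕ.≤-reflexive (≡.sym (ℕ.+-identityʳ M))) inv₀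
    in N , s′ , t , ⇓ , post , ℕ.≤-trans (ℕ.≤-reflexive (≡.sym (ℕ.+-identityʳ t))) t≤
    where
    o r : ℕ
    o = 1 ℕ.+ costₜ b
    r = o ℕ.+ a
    go : ∀ fuel j {s} → M ℕ.≤ fuel ℕ.+ j → Inv j s →
      Σ[ N ∈ ℕ ] Σ[ s′ ∈ State ] Σ[ t ∈ ℕ ] (⟨ while b P , s ⟩⇓⟨ s′ , t ⟩) ×
        (Inv N s′ × test s′ b ≡ false) × t ℕ.+ j ℕ.* r ℕ.≤ N ℕ.* r ℕ.+ o
    go fuel j {s} M≤ inv with test s b in eq
    ... | false = j , s , _ , ⇓-stop eq , (inv , eq) , ℕ.≤-reflexive (ℕ.+-comm o (j ℕ.* r))
    go zero j M≤ inv | true = contradiction (proj₁ (step inv eq)) (ℕ.≤⇒≯ M≤)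
    go (suc fuel) j M≤ inv | true with step inv eq
    ... | _ , s′ , t , P⇓ , inv′ , t≤a =
      let N , s″ , u , while⇓ , post , u≤ =
            go fuel (suc j) (ℕ.≤-trans M≤ (ℕ.≤-reflexive (≡.sym (ℕ.+-suc fuel j)))) inv′
      in N , s″ , _ , ⇓-loop eq P⇓ while⇓ , post , (begin
        o ℕ.+ t ℕ.+ u ℕ.+ j ℕ.* r   ≤⟨ ℕ.+-monoˡ-≤ (j ℕ.* r) (ℕ.+-monoˡ-≤ u (ℕ.+-monoʳ-≤ o t≤a)) ⟩
        r ℕ.+ u ℕ.+ j ℕ.* r         ≡⟨ solve 3 (λ r u p → r :+ u :+ p := u :+ (r :+ p)) ≡.refl r u (j ℕ.* r) ⟩
        u ℕ.+ suc j ℕ.* r           ≤⟨ u≤ ⟩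
        N ℕ.* r ℕ.+ o               ∎)
      where
      open ℕ.≤-Reasoning
      open +-*-Solver

  -- The body must establish the invariant in the state after the increment, so that the invariant
  -- can fix the counter cell. Carrying `x ≤ N` along makes the failed guard yield exactly `x ≡ N`.
  run-for : ∀ {p} {P a e N} → (∀ s → evalℕ s e ≡ N) → (Inv : ℕ → State → Set p) →
    (∀ {x s} → Inv x s → nats s 2 0 ≡ x) →
    (∀ {s} → nats s 2 0 ℕ.< N → Inv (nats s 2 0) s →
      Run P s (λ s′ → Inv (suc (nats s 2 0)) (assign s′ nat 2 0 (xE +ₑ lit 1))) a) →
    ∀ {s} → Inv 0 s →
    Run (forX e P) s (Inv N) (N ℕ.* (6 ℕ.+ costₑ e ℕ.+ (a ℕ.+ 6)) ℕ.+ (6 ℕ.+ costₑ e))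
  run-for {P = P} {a} {e} {N} eval-e Inv counter body {s} inv₀
    with run-while {b = xE +ₑ lit 1 ≤ₑ e} {P = P ︔ store nat 2 (lit 0) (xE +ₑ lit 1)} {a = a ℕ.+ 6}
           Inv′ N step (z≤n , inv₀)
    where
    Inv′ : ℕ → State → Set _
    Inv′ x s = x ℕ.≤ N × Inv x s
    step : ∀ {x s} → Inv′ x s → test s (xE +ₑ lit 1 ≤ₑ e) ≡ true → x ℕ.< N × Run _ s (Inv′ (suc x)) (a ℕ.+ 6)
    step {x} {s} (_ , inv) guard with counter inv
    ... | ≡.refl = x<N , body x<N inv run-︔ λ inv′ → run-store (x<N , inv′)
      where
      x<N : x ℕ.< N
      x<N = ≡.subst₂ ℕ._≤_ (ℕ.+-comm x 1) (eval-e s) (≤ᵇ-true⇒≤ guard)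
  ... | x , s′ , t , ⇓ , ((x≤N , inv) , guard) , t≤ with counter inv
  ... | ≡.refl = s′ , t , ⇓ , ≡.subst (λ x → Inv x s′) x≡N inv , ≡.subst (λ x → t ℕ.≤ x ℕ.* _ ℕ.+ _) x≡N t≤
    where
    x≡N : x ≡ N
    x≡N = ℕ.≤-antisym x≤N (ℕ.≮⇒≥ (λ x<N → ≤ᵇ-false⇒≰ guard
      (≡.subst₂ ℕ._≤_ (ℕ.+-comm 1 x) (≡.sym (eval-e s′)) x<N)))

  -- Invariants of the rounds and of the two passes within a round

  γ : ℕ → ℕ
  γ = atℕ 0 (λ x → toℕ (group x))

  δ : ℕ → ℕ → Carrier
  δ x y = atℕ 0# (λ x → atℕ 0# (λ y → d x y) y) x

  best : State → ℕ → ℕ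
  best s y = nats s 1 (γ y)

  limit : Carrier
  limit = (fromℕ 8 / ε) ^ dim * fromℕ k

  Fresh : State → Set c
  Fresh s = (∀ y → nats s 0 y ≡ 0) × nats s 3 0 ≡ 0 × (∀ y → reals s 0 y ≡ 0#)

  update-hit : ∀ {a} {A : Set a} {i j} {v w : A} → i ≡ j → (if i ≡ᵇ j then v else w) ≡ v
  update-hit {i = i} {j} i≡j rewrite dec-true (i ℕ.≟ j) i≡j = ≡.refl

  update-miss : ∀ {a} {A : Set a} {i j} {v w : A} → i ≢ j → (if i ≡ᵇ j then v else w) ≡ w
  update-miss {i = i} {j} i≢j rewrite dec-false (i ℕ.≟ j) i≢j = ≡.refl

  -- Ghost data: the centres chosen so far in each group, newest first. The memory holds only the
  -- newest centre of each group and the marks.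
  Selection : Set
  Selection = ℕ → List ℕ

  InGroup : ℕ → ℕ → Set
  InGroup y p = p ℕ.< n × γ p ≡ γ y

  -- The minimum of `δ y` over `ps`, described by its lower bounds. The greedy argument uses one
  -- direction at the queried point and the other at the new centre.
  record DistanceTo (y : ℕ) (ps : List ℕ) (v : Carrier) : Set (c ⊔ ℓ₂) where
    field
      lower    : ∀ {r} → r ≤ v → All (λ p → r ≤ δ y p) ps
      greatest : ∀ {r} → All (λ p → r ≤ δ y p) ps → r ≤ v

  -- Before the first round the minimum over no centres would be infinite, while the cells contain
  -- 0; this needs a case of its own.
  data Progress (L : Selection) (j : ℕ) (s : State) : Set (c ⊔ ℓ₂) where
    none : j ≡ 0 → (∀ g → L g ≡ []) → (∀ y → reals s 0 y ≡ 0#) → Progress L j s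
    some : 1 ℕ.≤ j → (∀ y → y ℕ.< n → InGroup y (best s y)) →
           (∀ {y} → y ℕ.< n → DistanceTo y (L (γ y)) (reals s 0 y)) → Progress L j s

  -- The lists of groups without points grow as well, by meaningless entries. Hence every claim
  -- about entries concerns `L (γ y)` for an actual point `y`. Entries may repeat once a group has
  -- no new point to offer.
  record Selected (L : Selection) (j : ℕ) (s : State) : Set (c ⊔ ℓ₁ ⊔ ℓ₂) where
    field
      counter  : nats s 3 0 ≡ j
      limit≈   : reals s 1 0 ≈ limit
      bounded  : fromℕ j ≤ limit
      progress : Progress L j s
      lengths  : ∀ g → length (L g) ≡ j
      inGroup  : ∀ {y} → y ℕ.< n → All (InGroup y) (L (γ y))
      marked   : ∀ {y} → y ℕ.< n → All (λ p → nats s 0 p ≡ 1) (L (γ y))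
      sound    : ∀ p → nats s 0 p ≡ 0 ⊎ (∃[ y ] y ℕ.< n × p ∈ˡ L (γ y))
      greedy   : ∀ {y} → y ℕ.< n → ∀ {r} → All (λ p → r ≤ δ y p) (L (γ y)) →
                 AllPairs (λ p p′ → r ≤ δ p p′) (L (γ y))

  module _ (s₀ : State) where

    -- `s₀` is the state before the pass. The candidates are not reset between rounds: an old centre
    -- is a harmless start because it belongs to the group. In the first round the candidate may lie
    -- in a foreign group, but all distances are 0, so the test succeeds at every point. `seeded`
    -- records this alternative.
    record Improved (x : ℕ) (s : State) : Set (c ⊔ ℓ₂) where
      field
        counter : nats s 2 0 ≡ x
        reals≡  : reals s ≡ reals s₀
        marks≡  : nats s 0 ≡ nats s₀ 0
        j≡      : nats s 3 0 ≡ nats s₀ 3 0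
        done    : ∀ {y} → y ℕ.< x → y ℕ.< n → InGroup y (best s y) × reals s₀ 0 y ≤ reals s₀ 0 (best s y)
        seeded  : (∀ y → y ℕ.< n → InGroup y (best s y)) ⊎ (∀ y → reals s₀ 0 y ≡ 0#)

    improve-step : ∀ {s} → nats s 2 0 ℕ.< n → Improved (nats s 2 0) s →
      Run improve s (λ s′ → Improved (suc (nats s 2 0)) (assign s′ nat 2 0 (xE +ₑ lit 1))) 16
    improve-step {s} x<n inv = run-branch-store closer further
      where
      open Improved inv
      x g b : ℕ
      x = nats s 2 0
      g = γ x
      b = nats s 1 g

      closer : does (reals s 0 b ≤? reals s 0 x) ≡ true → _
      closer test = record
        { counter = ℕ.+-comm x 1 ; reals≡ = reals≡ ; marks≡ = marks≡ ; j≡ = j≡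
        ; done = done′ ; seeded = Sum.map₁ seeded′ seeded }
        where
        b≤x : reals s₀ 0 b ≤ reals s₀ 0 x
        b≤x = ≡.subst (λ r → r 0 b ≤ r 0 x) reals≡ (does≡true⇒ (reals s 0 b ≤? reals s 0 x) test)
        Q : ℕ → ℕ → Set _
        Q y z = InGroup y z × reals s₀ 0 y ≤ reals s₀ 0 z
        done′ : ∀ {y} → y ℕ.< suc x → y ℕ.< n → Q y (if g ≡ᵇ γ y then x else best s y)
        done′ {y} y≤x y<n with g ℕ.≟ γ y | ℕ.m≤n⇒m<n∨m≡n (ℕ.s≤s⁻¹ y≤x)
        ... | yes g≡ | inj₁ y<x = ≡.subst (Q y) (≡.sym (update-hit g≡))
          ((x<n , g≡) , ≤-trans (proj₂ (done y<x y<n))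
            (≡.subst (λ h → reals s₀ 0 (nats s 1 h) ≤ reals s₀ 0 x) g≡ b≤x))
        ... | yes g≡ | inj₂ ≡.refl = ≡.subst (Q y) (≡.sym (update-hit g≡)) ((x<n , g≡) , ≤-refl)
        ... | no  g≢ | inj₁ y<x = ≡.subst (Q y) (≡.sym (update-miss g≢)) (done y<x y<n)
        ... | no  g≢ | inj₂ ≡.refl = contradiction ≡.refl g≢
        seeded′ : (∀ y → y ℕ.< n → InGroup y (best s y)) →
          ∀ y → y ℕ.< n → InGroup y (if g ≡ᵇ γ y then x else best s y)
        seeded′ valid y y<n with g ℕ.≟ γ y
        ... | yes g≡ = ≡.subst (InGroup y) (≡.sym (update-hit g≡)) (x<n , g≡)
        ... | no  g≢ = ≡.subst (InGroup y) (≡.sym (update-miss g≢)) (valid y y<n)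

      further : does (reals s 0 b ≤? reals s 0 x) ≡ false → _
      further test = record
        { counter = ℕ.+-comm x 1 ; reals≡ = reals≡ ; marks≡ = marks≡ ; j≡ = j≡
        ; done = done′ ; seeded = seeded }
        where
        b≰x : ¬ (reals s₀ 0 b ≤ reals s₀ 0 x)
        b≰x b≤x = does≡false⇒¬ (reals s 0 b ≤? reals s 0 x) test
          (≡.subst (λ r → r 0 b ≤ r 0 x) (≡.sym reals≡) b≤x)
        valid : InGroup x b
        valid with seeded
        ... | inj₁ valid = valid x x<n
        ... | inj₂ zero! = contradiction (≤-reflexive (reflexive (≡.trans (zero! b) (≡.sym (zero! x))))) b≰x
        done′ : ∀ {y} → y ℕ.< suc x → y ℕ.< n → InGroup y (best s y) × reals s₀ 0 y ≤ reals s₀ 0 (best s y)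
        done′ y≤x y<n with ℕ.m≤n⇒m<n∨m≡n (ℕ.s≤s⁻¹ y≤x)
        ... | inj₁ y<x    = done y<x y<n
        ... | inj₂ ≡.refl = valid , proj₁ (≰⇒> b≰x)

    -- Outside the first round this is the minimum of the old distance and the distance to the new
    -- centre. In the first round the old value is no distance yet and must be replaced.
    data Updated (y : ℕ) (v : Carrier) : Set (c ⊔ ℓ₂) where
      replaced : v ≡ δ y (best s₀ y) → nats s₀ 3 0 ≡ 0 ⊎ δ y (best s₀ y) ≤ reals s₀ 0 y → Updated y v
      kept     : v ≡ reals s₀ 0 y → 1 ℕ.≤ nats s₀ 3 0 → reals s₀ 0 y ≤ δ y (best s₀ y) → Updated y v

    record Marked (x : ℕ) (s : State) : Set (c ⊔ ℓ₂) where
      field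
        counter : nats s 2 0 ≡ x
        best≡   : nats s 1 ≡ nats s₀ 1
        j≡      : nats s 3 0 ≡ nats s₀ 3 0
        limit≡  : reals s 1 0 ≡ reals s₀ 1 0
        done    : ∀ {y} → y ℕ.< x → Updated y (reals s 0 y)
        todo    : ∀ {y} → x ℕ.≤ y → reals s 0 y ≡ reals s₀ 0 y
        new     : ∀ {y} → y ℕ.< x → nats s 0 (best s₀ y) ≡ 1
        old     : ∀ {p} → nats s₀ 0 p ≡ 1 → nats s 0 p ≡ 1
        sound   : ∀ p → nats s 0 p ≡ nats s₀ 0 p ⊎ (∃[ y ] y ℕ.< n × p ≡ best s₀ y)

    mark-step : ∀ {s} → nats s 2 0 ℕ.< n → Marked (nats s 2 0) s →
      Run mark s (λ s′ → Marked (suc (nats s 2 0)) (assign s′ nat 2 0 (xE +ₑ lit 1))) 35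
    mark-step {s} x<n inv = run-branch-store {Post = AfterBranch} replace keep run-︔ mark-best
      where
      open Marked inv
      x b : ℕ
      x = nats s 2 0
      b = best s x
      b≡ : b ≡ best s₀ x
      b≡ = ≡.cong (λ f → f (γ x)) best≡

      record AfterBranch (s′ : State) : Set (c ⊔ ℓ₂) where
        field
          nats≡   : nats s′ ≡ nats s
          limit≡′ : reals s′ 1 0 ≡ reals s₀ 1 0
          done′   : ∀ {y} → y ℕ.< suc x → Updated y (reals s′ 0 y)
          todo′   : ∀ {y} → suc x ℕ.≤ y → reals s′ 0 y ≡ reals s₀ 0 y

      replace : _ → AfterBranch (assign s real 0 x nearE)
      replace test = record
        { nats≡ = ≡.refl ; limit≡′ = limit≡ ; done′ = done″
        ; todo′ = λ x<y → ≡.trans (update-miss (ℕ.<⇒≢ x<y)) (todo (ℕ.<⇒≤ x<y)) }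
        where
        reason : nats s₀ 3 0 ≡ 0 ⊎ δ x (best s₀ x) ≤ reals s₀ 0 x
        reason with ∧-false (not-injective {y = false} test)
        ... | inj₁ j≢  = inj₁ (≡.trans (≡.sym j≡) (ℕ.n<1⇒n≡0 (ℕ.≰⇒> (≤ᵇ-false⇒≰ j≢))))
        ... | inj₂ δ≤ = inj₂ (≡.subst₂ (λ p v → δ x p ≤ v) b≡ (todo ℕ.≤-refl)
                          (does≡true⇒ (δ x b ≤? reals s 0 x) (not-injective {y = true} δ≤)))
        done″ : ∀ {y} → y ℕ.< suc x → Updated y (if x ≡ᵇ y then δ x b else reals s 0 y)
        done″ {y} y≤x with ℕ.m≤n⇒m<n∨m≡n (ℕ.s≤s⁻¹ y≤x)
        ... | inj₁ y<x    = ≡.subst (Updated y) (≡.sym (update-miss (ℕ.<⇒≢ y<x ∘ ≡.sym))) (done y<x)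
        ... | inj₂ ≡.refl = replaced (≡.trans (update-hit {i = x} ≡.refl) (≡.cong (δ x) b≡)) reason

      keep : _ → AfterBranch s
      keep test = record
        { nats≡ = ≡.refl ; limit≡′ = limit≡ ; done′ = done″ ; todo′ = λ x<y → todo (ℕ.<⇒≤ x<y) }
        where
        guard : ((1 ≤ᵇ nats s 3 0) ∧ not (does (δ x b ≤? reals s 0 x))) ≡ true
        guard = not-injective {y = true} test
        both : (1 ≤ᵇ nats s 3 0) ≡ true × not (does (δ x b ≤? reals s 0 x)) ≡ true
        both = ∧-conicalˡ _ _ guard , ∧-conicalʳ _ _ guard
        done″ : ∀ {y} → y ℕ.< suc x → Updated y (reals s 0 y)
        done″ {y} y≤x with ℕ.m≤n⇒m<n∨m≡n (ℕ.s≤s⁻¹ y≤x)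
        ... | inj₁ y<x    = done y<x
        ... | inj₂ ≡.refl = kept (todo ℕ.≤-refl) (≡.subst (1 ℕ.≤_) j≡ (≤ᵇ-true⇒≤ (proj₁ both)))
          (≡.subst₂ (λ p v → v ≤ δ x p) b≡ (todo ℕ.≤-refl)
            (proj₁ (≰⇒> (does≡false⇒¬ (δ x b ≤? reals s 0 x) (not-injective {y = false} (proj₂ both))))))

      mark-best : ∀ {s′} → AfterBranch s′ →
        Run (store nat 0 (bestE (groupOf xE)) (lit 1)) s′
          (λ s″ → Marked (suc x) (assign s″ nat 2 0 (xE +ₑ lit 1))) 6
      mark-best {state _ _} after with AfterBranch.nats≡ after
      ... | ≡.refl = run-store (record
        { counter = ℕ.+-comm x 1 ; best≡ = best≡ ; j≡ = j≡ ; limit≡ = limit≡′ ; done = done′ ; todo = todo′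
        ; new = new′ ; old = old′ ; sound = sound′ })
        where
        open AfterBranch after
        mark≡ : ℕ → ℕ
        mark≡ p = if b ≡ᵇ p then 1 else nats s 0 p
        still : ∀ p → nats s 0 p ≡ 1 → mark≡ p ≡ 1
        still p eq with b ≡ᵇ p
        ... | true  = ≡.refl
        ... | false = eq
        new′ : ∀ {y} → y ℕ.< suc x → mark≡ (best s₀ y) ≡ 1
        new′ {y} y≤x with ℕ.m≤n⇒m<n∨m≡n (ℕ.s≤s⁻¹ y≤x)
        ... | inj₁ y<x    = still (best s₀ y) (new y<x)
        ... | inj₂ ≡.refl = update-hit b≡
        old′ : ∀ {p} → nats s₀ 0 p ≡ 1 → mark≡ p ≡ 1
        old′ {p} eq = still p (old eq)
        sound′ : ∀ p → mark≡ p ≡ nats s₀ 0 p ⊎ (∃[ y ] y ℕ.< n × p ≡ best s₀ y)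
        sound′ p with b ℕ.≟ p
        ... | yes b≡p = inj₂ (x , x<n , ≡.trans (≡.sym b≡p) b≡)
        ... | no  b≢p = [ (λ eq → inj₁ (≡.trans (update-miss b≢p) eq)) , inj₂ ]′ (sound p)

  -- One round and the whole program

  roundCost : ℕ
  roundCost = 3 ℕ.+ ((n ℕ.* 29 ℕ.+ 7) ℕ.+ (3 ℕ.+ ((n ℕ.* 48 ℕ.+ 7) ℕ.+ 6)))

  programCost : ℕ → ℕ
  programCost N = (m ℕ.* 21 ℕ.+ 7) ℕ.+ (5 ℕ.+ (3 ℕ.+ ((dim ℕ.* 22 ℕ.+ 7) ℕ.+
    (N ℕ.* (14 ℕ.+ roundCost) ℕ.+ 14))))

  run-round : ∀ {L j s} → Selected L j s → fromℕ (suc j) ≤ limit →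
    Run round s (λ s′ → Σ[ L′ ∈ Selection ] Selected L′ (suc j) s′) roundCost
  run-round {L} {j} {s} sel 1+j≤limit =
    run-store {Post = Improved s 0} start-improve run-︔ λ start →
    run-for (λ _ → ≡.refl) (Improved s) Improved.counter (improve-step s) start run-︔ λ improved →
    run-store {Post = Started} (_ , improved , start-mark) run-︔ λ (s₂ , improved , start) →
    run-for (λ _ → ≡.refl) (Marked s₂) Marked.counter (mark-step s₂) start run-︔ λ marked →
    run-store (_ , finish improved marked)
    where
    open Selected sel

    start-improve : Improved s 0 (assign s nat 2 0 (lit 0))
    start-improve = record
      { counter = ≡.refl ; reals≡ = ≡.refl ; marks≡ = ≡.refl ; j≡ = ≡.refl
      ; done = λ () ; seeded = seeded′ progress }
      where
      seeded′ : Progress L j s → _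
      seeded′ (none _ _ zero!) = inj₂ zero!
      seeded′ (some _ valid _) = inj₁ valid

    Started : State → Set _
    Started s′ = Σ[ s₂ ∈ State ] Improved s n s₂ × Marked s₂ 0 s′

    start-mark : ∀ {s₂} → Marked s₂ 0 (assign s₂ nat 2 0 (lit 0))
    start-mark = record
      { counter = ≡.refl ; best≡ = ≡.refl ; j≡ = ≡.refl ; limit≡ = ≡.refl
      ; done = λ () ; todo = λ _ → ≡.refl ; new = λ () ; old = id ; sound = λ _ → inj₁ ≡.refl }

    finish : ∀ {s₂ s₃} → Improved s n s₂ → Marked s₂ n s₃ →
      Selected (λ g → nats s₂ 1 g ∷ L g) (suc j) (assign s₃ nat 3 0 (jE +ₑ lit 1))
    finish {s₂} {s₃} improved marked′ = record
      { counter  = ≡.trans (≡.cong (ℕ._+ 1) (≡.trans M.j≡ j₂)) (ℕ.+-comm j 1)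
      ; limit≈   = trans (reflexive (≡.trans M.limit≡ (≡.cong (λ r → r 1 0) A.reals≡))) limit≈
      ; bounded  = 1+j≤limit
      ; progress = some (s≤s z≤n)
          (λ y y<n → ≡.subst (λ f → InGroup y (f (γ y))) (≡.sym M.best≡) (valid y<n))
          (λ y<n → distance′ y<n progress (M.done y<n))
      ; lengths  = λ g → ≡.cong suc (lengths g)
      ; inGroup  = λ y<n → valid y<n ∷ inGroup y<n
      ; marked   = λ y<n → M.new y<n ∷
          All.map (λ {p} eq → M.old (≡.trans (≡.cong (λ f → f p) A.marks≡) eq)) (marked y<n)
      ; sound    = sound′
      ; greedy   = λ y<n → greedy′ y<n progress
      }
      where
      module A = Improved improved
      module M = Marked marked′

      j₂ : nats s₂ 3 0 ≡ j
      j₂ = ≡.trans A.j≡ counter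

      valid : ∀ {y} → y ℕ.< n → InGroup y (best s₂ y)
      valid y<n = proj₁ (A.done y<n y<n)

      dist₂ : ∀ y → reals s₂ 0 y ≡ reals s 0 y
      dist₂ y = ≡.cong (λ r → r 0 y) A.reals≡

      distance′ : ∀ {y v} → y ℕ.< n → Progress L j s → Updated s₂ y v → DistanceTo y (best s₂ y ∷ L (γ y)) v
      distance′ {y} y<n (none _ empty _) (replaced ≡.refl _) rewrite empty (γ y) =
        record { lower = λ r≤ → r≤ ∷ [] ; greatest = All.head }
      distance′ y<n (none j≡0 _ _) (kept _ 1≤j _) =
        contradiction (≡.trans (≡.sym j≡0) (≡.sym j₂)) (ℕ.<⇒≢ 1≤j)
      distance′ y<n (some 1≤j _ _) (replaced _ (inj₁ j≡0)) =
        contradiction (≡.trans (≡.sym j≡0) j₂) (ℕ.<⇒≢ 1≤j)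
      distance′ {y} y<n (some _ _ dist) (replaced ≡.refl (inj₂ δ≤dist)) = record
        { lower    = λ r≤δ → r≤δ ∷ DistanceTo.lower (dist y<n) (≤-trans r≤δ (≡.subst (_ ≤_) (dist₂ y) δ≤dist))
        ; greatest = All.head }
      distance′ {y} y<n (some _ _ dist) (kept ≡.refl _ dist≤δ) = record
        { lower    = λ r≤ → ≤-trans r≤ dist≤δ ∷ DistanceTo.lower (dist y<n) (≡.subst (_ ≤_) (dist₂ y) r≤)
        ; greatest = λ { (_ ∷ r≤) → ≡.subst (_ ≤_) (≡.sym (dist₂ y)) (DistanceTo.greatest (dist y<n) r≤) } }

      greedy′ : ∀ {y} → y ℕ.< n → Progress L j s → ∀ {r} → All (λ p → r ≤ δ y p) (best s₂ y ∷ L (γ y)) →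
        AllPairs (λ p p′ → r ≤ δ p p′) (best s₂ y ∷ L (γ y))
      greedy′ {y} y<n (none _ empty _) _ rewrite empty (γ y) = [] ∷ []
      greedy′ {y} y<n (some _ _ dist) {r} (_ ∷ r≤) = best-far ∷ greedy y<n r≤
        where
        b : ℕ
        b = best s₂ y
        -- `greatest` turns the assumption on `y` into a bound on its stored distance, which `b`
        -- maximises over the group; `lower` turns the resulting bound at `b` back into distances to
        -- the earlier centres. These are the centres of the group of `y`, since `b` lies in that
        -- group.
        r≤dist-b : r ≤ reals s 0 b
        r≤dist-b = ≤-trans (DistanceTo.greatest (dist y<n) r≤) (proj₂ (A.done y<n y<n))
        best-far : All (λ p → r ≤ δ b p) (L (γ y))
        best-far = ≡.subst (λ g → All (λ p → r ≤ δ b p) (L g)) (proj₂ (valid y<n))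
          (DistanceTo.lower (dist (proj₁ (valid y<n))) r≤dist-b)

      sound′ : ∀ p → nats s₃ 0 p ≡ 0 ⊎ (∃[ y ] y ℕ.< n × p ∈ˡ (best s₂ y ∷ L (γ y)))
      sound′ p with M.sound p
      ... | inj₂ (y , y<n , p≡) = inj₂ (y , y<n , here p≡)
      ... | inj₁ eq with sound p
      ...   | inj₁ p≡0            = inj₁ (≡.trans eq (≡.trans (≡.cong (λ f → f p) A.marks≡) p≡0))
      ...   | inj₂ (y , y<n , p∈) = inj₂ (y , y<n , there p∈)

  record Summed (x : ℕ) (s : State) : Set c where
    field
      counter : nats s 2 0 ≡ x
      quotas  : nats s 4 0 ≡ prefixSum (atℕ 0 quota) x
      fresh   : Fresh s

  record Scaled (x : ℕ) (s : State) : Set (c ⊔ ℓ₁) where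
    field
      counter : nats s 2 0 ≡ x
      value   : reals s 1 0 ≈ (fromℕ 8 / ε) ^ x * fromℕ k
      fresh   : Fresh s

  Finished : ℕ → State → Set (c ⊔ ℓ₁ ⊔ ℓ₂)
  Finished N s = (Σ[ L ∈ Selection ] Selected L N s) × (¬ (fromℕ (suc N) ≤ limit) ⊎ n ℕ.< N)

  run-program : 0# ≤ limit → Σ[ N ∈ ℕ ] Run program initial (Finished N) (programCost N)
  run-program 0≤limit =
    run-for (λ _ → ≡.refl) Summed Summed.counter add-quota summed₀ run-︔ᴺ λ summed →
    run-store {Post = Started} (start-scale summed) run-︔ᴺ λ started →
    run-store {Post = Scaled 0} (scaled₀ started) run-︔ᴺ λ scaled →
    run-for (λ _ → ≡.refl) Scaled Scaled.counter scale-limit scaled run-︔ᴺ run-rounds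
    where
    infixr 5 _run-︔ᴺ_
    -- The number of rounds is known only when the last loop halts, so sequencing has to pass it
    -- outwards.
    _run-︔ᴺ_ : ∀ {p q} {Mid : State → Set p} {Post : ℕ → State → Set q} {P Q s a} {b : ℕ → ℕ} →
      Run P s Mid a → (∀ {s′} → Mid s′ → Σ[ N ∈ ℕ ] Run Q s′ (Post N) (b N)) →
      Σ[ N ∈ ℕ ] Run (P ︔ Q) s (Post N) (a ℕ.+ b N)
    (s′ , t , P⇓ , mid , t≤a) run-︔ᴺ Q-run =
      let N , s″ , u , Q⇓ , post , u≤b = Q-run mid
      in N , s″ , t ℕ.+ u , ⇓-seq P⇓ Q⇓ , post , ℕ.+-mono-≤ t≤a u≤b

    summed₀ : Summed 0 initial
    summed₀ = record { counter = ≡.refl ; quotas = ≡.refl ; fresh = (λ _ → ≡.refl) , ≡.refl , λ _ → ≡.refl }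

    add-quota : ∀ {s} → nats s 2 0 ℕ.< m → Summed (nats s 2 0) s →
      Run addQuota s (λ s′ → Summed (suc (nats s 2 0)) (assign s′ nat 2 0 (xE +ₑ lit 1))) 8
    add-quota {s} _ inv = run-store (record
      { counter = ℕ.+-comm (nats s 2 0) 1
      ; quotas = ≡.cong (ℕ._+ atℕ 0 quota (nats s 2 0)) quotas ; fresh = fresh })
      where
      open Summed inv

    -- The factor `1#` is the power with exponent 0 that `Scaled 0` expects.
    Started : State → Set (c ⊔ ℓ₁)
    Started s = reals s 1 0 ≈ 1# * fromℕ k × Fresh s

    start-scale : ∀ {s} → Summed m s → Started (assign s real 1 0 (toReal kE))
    start-scale {s} summed = trans (reflexive (≡.cong fromℕ
        (≡.trans quotas (prefixSum≡foldr (atℕ 0 quota) quota (atℕ-toℕ 0 quota))))) (sym (*-identityˡ _)) , fresh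
      where
      open Summed summed

    scaled₀ : ∀ {s} → Started s → Scaled 0 (assign s nat 2 0 (lit 0))
    scaled₀ (value , fresh) = record { counter = ≡.refl ; value = value ; fresh = fresh }

    scale-limit : ∀ {s} → nats s 2 0 ℕ.< dim → Scaled (nats s 2 0) s →
      Run scaleLimit s (λ s′ → Scaled (suc (nats s 2 0)) (assign s′ nat 2 0 (xE +ₑ lit 1))) 9
    scale-limit {s} _ inv = run-store (record
      { counter = ℕ.+-comm (nats s 2 0) 1
      ; value = trans (*-congˡ value) (sym (*-assoc _ _ _)) ; fresh = fresh })
      where
      open Scaled inv

    run-rounds : ∀ {s} → Scaled dim s → Σ[ N ∈ ℕ ]
      Run (while (toReal (jE +ₑ lit 1) ≤ₑ limitE andₑ jE ≤ₑ #points) round) s (Finished N)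
          (N ℕ.* (14 ℕ.+ roundCost) ℕ.+ 14)
    run-rounds {s} scaled =
      let N , s′ , t , ⇓ , ((L , sel) , guard) , t≤ =
            run-while (λ j s → Σ[ L ∈ Selection ] Selected L j s) (suc n) step ((λ _ → []) , start)
      in N , s′ , t , ⇓ , ((L , sel) , stop sel guard) , t≤
      where
      fresh : Fresh s
      fresh = Scaled.fresh scaled
      start : Selected (λ _ → []) 0 s
      start = record
        { counter = proj₁ (proj₂ fresh) ; limit≈ = Scaled.value scaled ; bounded = 0≤limit
        ; progress = none ≡.refl (λ _ → ≡.refl) (proj₂ (proj₂ fresh)) ; lengths = λ _ → ≡.refl
        ; inGroup = λ _ → [] ; marked = λ _ → [] ; sound = λ p → inj₁ (proj₁ fresh p) ; greedy = λ _ _ → [] }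
      module _ {L j s} (sel : Selected L j s) where
        open Selected sel
        limit? : Dec (fromℕ (nats s 3 0 ℕ.+ 1) ≤ reals s 1 0)
        limit? = fromℕ (nats s 3 0 ℕ.+ 1) ≤? reals s 1 0
        j+1≡ : nats s 3 0 ℕ.+ 1 ≡ suc j
        j+1≡ = ≡.trans (≡.cong (ℕ._+ 1) counter) (ℕ.+-comm j 1)
      step : ∀ {j s} → Σ[ L ∈ Selection ] Selected L j s → _ → j ℕ.< suc n × Run round s _ roundCost
      step {j} {s} (L , sel) guard =
        let limit-ok = ∧-conicalˡ _ _ guard
            j≤n      = ∧-conicalʳ _ _ guard in
        s≤s (≡.subst (ℕ._≤ n) counter (≤ᵇ-true⇒≤ j≤n)) ,
        run-round sel (≤-respʳ-≈ limit≈
          (≡.subst (λ a → fromℕ a ≤ reals s 1 0) (j+1≡ sel) (does≡true⇒ (limit? sel) limit-ok)))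
        where
        open Selected sel
      stop : ∀ {L N s} → Selected L N s → test s (toReal (jE +ₑ lit 1) ≤ₑ limitE andₑ jE ≤ₑ #points) ≡ false →
        ¬ (fromℕ (suc N) ≤ limit) ⊎ n ℕ.< N
      stop {N = N} {s} sel guard with ∧-false guard
      ... | inj₁ over = inj₁ (λ 1+N≤limit → does≡false⇒¬ (limit? sel) over
              (≡.subst (λ a → fromℕ a ≤ reals s 1 0) (≡.sym (j+1≡ sel)) (≤-respʳ-≈ (sym limit≈) 1+N≤limit)))
        where
        open Selected sel
      ... | inj₂ over = inj₂ (≡.subst (n ℕ.<_) counter (ℕ.≰⇒> (≤ᵇ-false⇒≰ over)))
        where
        open Selected sel

-- Size and running time

1≤foldr⇒1≤ : ∀ {m} (q : Fin m → ℕ) → 1 ℕ.≤ Vector.foldr ℕ._+_ 0 q → ∃[ i ] 1 ℕ.≤ q i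
1≤foldr⇒1≤ {suc m} q 1≤ with q zero in eq
... | suc _ = zero , ≡.subst (1 ℕ.≤_) (≡.sym eq) (s≤s z≤n)
... | zero  = let i , 1≤qi = 1≤foldr⇒1≤ (q ∘ suc) 1≤ in suc i , 1≤qi

length-concatMap : ∀ {a b} {A : Set a} {B : Set b} (f : A → List B) {l} → (∀ x → length (f x) ≡ l) →
  ∀ xs → length (concatMap f xs) ≡ length xs ℕ.* l
length-concatMap f lengths []       = ≡.refl
length-concatMap f lengths (x ∷ xs) = ≡.trans (length-++ (f x))
  (≡.cong₂ ℕ._+_ (lengths x) (length-concatMap f lengths xs))

restrict : ∀ {n} (ps : List ℕ) →
  Σ[ xs ∈ List (Fin n) ] length xs ℕ.≤ length ps × (∀ {x} → toℕ x ∈ˡ ps → x ∈ˡ xs)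
restrict []       = [] , z≤n , λ ()
restrict {n} (p ∷ ps) with restrict {n} ps | p ℕ.<? n
... | xs , ∣xs∣≤ , ps⊆xs | yes p<n = fromℕ< p<n ∷ xs , s≤s ∣xs∣≤ , λ
  { {x} (here x≡p) → here (Fin.toℕ-injective (≡.trans x≡p (≡.sym (Fin.toℕ-fromℕ< p<n))))
  ; (there x∈)     → there (ps⊆xs x∈) }
... | xs , ∣xs∣≤ , ps⊆xs | no  p≮n = xs , ℕ.m≤n⇒m≤1+n ∣xs∣≤ , λ
  { {x} (here x≡p) → contradiction (≡.subst (ℕ._< n) x≡p (Fin.toℕ<n x)) p≮n
  ; (there x∈)     → ps⊆xs x∈ }

lift : ∀ {n ps} → All (ℕ._< n) ps → Σ[ xs ∈ List (Fin n) ] map toℕ xs ≡ ps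
lift []           = [] , ≡.refl
lift (p<n ∷ ps<n) = let xs , eq = lift ps<n in fromℕ< p<n ∷ xs , ≡.cong₂ _∷_ (Fin.toℕ-fromℕ< p<n) eq

-- The value of `programCost` when `m`, `n`, `dim` and the number of rounds are all 1.
constant : ℕ
constant = (21 ℕ.+ 7) ℕ.+ (5 ℕ.+ (3 ℕ.+ ((22 ℕ.+ 7) ℕ.+
  ((14 ℕ.+ (3 ℕ.+ ((29 ℕ.+ 7) ℕ.+ (3 ℕ.+ ((48 ℕ.+ 7) ℕ.+ 6))))) ℕ.+ 14))))

module Correctness {c ℓ₁ ℓ₂} (F : OrderedField c ℓ₁ ℓ₂)
  {ε : OrderedField.Carrier F} (0<ε : OrderedField._<_ F (OrderedField.0# F) ε)
  (ε≤1 : OrderedField._≤_ F ε (OrderedField.1# F))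
  (I : Diversification.Instance F) (dim : ℕ)
  (doubling : Diversification.Instance.Doubling I dim) where
  open OrderedField F
  open Diversification F
  open Instance I
  open OrderedFieldProperties F
  open RealRAM F
  open Accuracy F 0<ε ε≤1
  open Coreset F 0<ε ε≤1 I dim doubling
  open Verification F I ε dim
  open ≤-Reasoning

  module _ {L : Selection} {N : ℕ} {s : State} (sel : Selected L N s) where
    open Selected sel

    net : ¬ (fromℕ (suc N) ≤ limit) ⊎ n ℕ.< N → ∀ u → Net (output s) u
    net stop u = record
      { centres   = xs
      ; sameGroup = All.map (λ {t} (_ , γt≡γu) → Fin.toℕ-injective
          (≡.trans (≡.sym (γ≡ t)) (≡.trans γt≡γu (γ≡ u)))) (fromSelection (inGroup u<n))
      ; selected  = All.map (λ marked → ∈-tabulate⁺ (≡.cong (1 ≤ᵇ_) marked)) (fromSelection (marked u<n))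
      ; greedy    = λ {r} far → AllPairs.map (λ {x} {y} → ≡.subst (r ≤_) (δ≡ x y))
          (AllPairs.map⁻ (≡.subst (AllPairs _) (≡.sym xs≡)
            (greedy u<n (toSelection (All.map (λ {x} → ≡.subst (r ≤_) (≡.sym (δ≡ u x))) far)))))
      ; exhausted = ≡.subst (λ l → ¬ (fromℕ (suc l) ≤ limit) ⊎ n ℕ.< l) (≡.sym ∣xs∣≡N) stop
      }
      where
      y : ℕ
      y = toℕ u
      u<n : y ℕ.< n
      u<n = Fin.toℕ<n u
      lifted : Σ[ xs ∈ List (Fin n) ] map toℕ xs ≡ L (γ y)
      lifted = lift (All.map proj₁ (inGroup u<n))
      xs : List (Fin n)
      xs = proj₁ lifted
      xs≡ : map toℕ xs ≡ L (γ y)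
      xs≡ = proj₂ lifted
      ∣xs∣≡N : length xs ≡ N
      ∣xs∣≡N = ≡.trans (≡.sym (length-map toℕ xs)) (≡.trans (≡.cong length xs≡) (lengths (γ y)))
      fromSelection : ∀ {p} {P : ℕ → Set p} → All P (L (γ y)) → All (P ∘ toℕ) xs
      fromSelection {P = P} = All.map⁻ ∘ ≡.subst (All P) (≡.sym xs≡)
      toSelection : ∀ {p} {P : ℕ → Set p} → All (P ∘ toℕ) xs → All P (L (γ y))
      toSelection {P = P} = ≡.subst (All P) xs≡ ∘ All.map⁺
      γ≡ : ∀ x → γ (toℕ x) ≡ toℕ (group x)
      γ≡ = atℕ-toℕ 0 (λ x → toℕ (group x))
      δ≡ : ∀ x y → δ (toℕ x) (toℕ y) ≡ d x y
      δ≡ x y = ≡.trans (atℕ-toℕ 0# _ x) (atℕ-toℕ 0# (d x) y)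

    ∣output∣≤ : ∣ output {n} s ∣ ℕ.≤ N ℕ.* m
    ∣output∣≤ = ℕ.≤-trans (∣p∣≤length (proj₁ points) (output s) (proj₂ (proj₂ points) ∘ output⊆))
      (ℕ.≤-trans (proj₁ (proj₂ points)) (ℕ.≤-reflexive
        (≡.trans (length-concatMap L lengths (upTo m))
        (≡.trans (≡.cong (ℕ._* N) (length-upTo m)) (ℕ.*-comm m N)))))
      where
      points : Σ[ xs ∈ List (Fin n) ] _ × (∀ {x} → toℕ x ∈ˡ concatMap L (upTo m) → x ∈ˡ xs)
      points = restrict (concatMap L (upTo m))
      γ<m : ∀ {y} → y ℕ.< n → γ y ℕ.< m
      γ<m {y} y<n with y ℕ.<? n
      ... | yes y<n = Fin.toℕ<n _
      ... | no  y≮n = contradiction y<n y≮n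
      output⊆ : ∀ {x} → x ∈ output s → toℕ x ∈ˡ concatMap L (upTo m)
      output⊆ {x} x∈ with sound (toℕ x)
      ... | inj₁ unmarked =
        contradiction (≡.subst (1 ℕ.≤_) unmarked
          (≤ᵇ-true⇒≤ (∈-tabulate⁻ {f = λ x → 1 ≤ᵇ nats s 0 (toℕ x)} x∈))) (λ ())
      ... | inj₂ (y , y<n , x∈L) = ∈-concatMap⁺ L (Any.map (λ { ≡.refl → x∈L }) (∈-upTo⁺ (γ<m y<n)))

    output-size : fromℕ ∣ output {n} s ∣ ≤ fromℕ constant * (D * fromℕ (k ℕ.* m))
    output-size = begin
      fromℕ ∣ output {n} s ∣           ≤⟨ fromℕ-mono ∣output∣≤ ⟩
      fromℕ (N ℕ.* m)                  ≈⟨ fromℕ-* N m ⟩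
      fromℕ N * fromℕ m                ≤⟨ *-monoˡ-≤ (fromℕ-nonNegative m) bounded ⟩
      D * fromℕ k * fromℕ m            ≈⟨ trans (*-assoc D _ _) (*-congˡ (sym (fromℕ-* k m))) ⟩
      D * fromℕ (k ℕ.* m)              ≤⟨ x≤x*y (*-nonNegative (1≤⇒0≤ 1≤D) (fromℕ-nonNegative (k ℕ.* m)))
                                                 (1≤fromℕ {constant} (s≤s z≤n)) ⟩
      D * fromℕ (k ℕ.* m) * fromℕ constant ≈⟨ *-comm _ _ ⟩
      fromℕ constant * (D * fromℕ (k ℕ.* m)) ∎

  module _ (N : ℕ) (N≤limit : fromℕ N ≤ limit) (1≤k : 1 ℕ.≤ k) where

    private
      B : Carrier
      B = D * fromℕ (k ℕ.* m ℕ.* n)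

      infix 4 _⊑_
      -- A calculus of bounds in units of the target `B`. Being a record, it lets both arguments be
      -- inferred from the type.
      record _⊑_ (a b : ℕ) : Set ℓ₂ where
        constructor bound
        field ≤bB : fromℕ a ≤ fromℕ b * B

      positive : ∃[ i ] 1 ℕ.≤ quota i
      positive = 1≤foldr⇒1≤ quota 1≤k

      1≤m : 1 ℕ.≤ m
      1≤m = ℕ.≤-trans (s≤s z≤n) (Fin.toℕ<n (proj₁ positive))

      1≤n : 1 ℕ.≤ n
      1≤n = ℕ.≤-trans (proj₂ positive) (ℕ.≤-trans (quota≤ _) (∣p∣≤n (class group (proj₁ positive))))

      1≤kmn : 1 ℕ.≤ k ℕ.* m ℕ.* n
      1≤kmn = ℕ.*-mono-≤ (ℕ.*-mono-≤ 1≤k 1≤m) 1≤n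

      D≤B : D ≤ B
      D≤B = x≤x*y (1≤⇒0≤ 1≤D) (1≤fromℕ 1≤kmn)

      ⊑1 : ∀ {a} → fromℕ a ≤ B → a ⊑ 1
      ⊑1 {a} a≤B = bound (begin
        fromℕ a      ≤⟨ a≤B ⟩
        B            ≈⟨ *-identityˡ B ⟨
        1# * B       ≈⟨ *-congʳ (+-identityʳ 1#) ⟨
        fromℕ 1 * B  ∎)

      ⊑-+ : ∀ {a a′ b b′} → a ⊑ b → a′ ⊑ b′ → a ℕ.+ a′ ⊑ b ℕ.+ b′
      ⊑-+ {a} {a′} {b} {b′} (bound a≤) (bound a′≤) = bound (begin
        fromℕ (a ℕ.+ a′)          ≈⟨ fromℕ-+ a a′ ⟩
        fromℕ a + fromℕ a′        ≤⟨ +-mono-≤ a≤ a′≤ ⟩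
        fromℕ b * B + fromℕ b′ * B ≈⟨ distribʳ B _ _ ⟨
        (fromℕ b + fromℕ b′) * B  ≈⟨ *-congʳ (fromℕ-+ b b′) ⟨
        fromℕ (b ℕ.+ b′) * B      ∎)

      ⊑-* : ∀ {a} → a ⊑ 1 → ∀ r → a ℕ.* r ⊑ r
      ⊑-* {a} (bound a≤) r = bound (begin
        fromℕ (a ℕ.* r)        ≈⟨ fromℕ-* a r ⟩
        fromℕ a * fromℕ r      ≤⟨ *-monoˡ-≤ (fromℕ-nonNegative r) a≤ ⟩
        fromℕ 1 * B * fromℕ r  ≈⟨ *-congʳ (trans (*-congʳ (+-identityʳ 1#)) (*-identityˡ B)) ⟩
        B * fromℕ r            ≈⟨ *-comm B _ ⟩
        fromℕ r * B            ∎)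

      constant⊑ : ∀ r → r ⊑ r
      constant⊑ r = ≡.subst (_⊑ r) (ℕ.*-identityˡ r)
        (⊑-* (⊑1 {1} (≤-trans (≤-reflexive (+-identityʳ 1#)) (≤-trans 1≤D D≤B))) r)

      m⊑1 : m ⊑ 1
      m⊑1 = ⊑1 (≤-trans (fromℕ-mono m≤kmn)
        (≤-respˡ-≈ (*-identityˡ _) (*-monoˡ-≤ (fromℕ-nonNegative (k ℕ.* m ℕ.* n)) 1≤D)))
        where
        m≤kmn : m ℕ.≤ k ℕ.* m ℕ.* n
        m≤kmn = ≡.subst (ℕ._≤ k ℕ.* m ℕ.* n) (≡.trans (ℕ.*-identityʳ _) (ℕ.*-identityˡ m))
          (ℕ.*-mono-≤ (ℕ.*-mono-≤ 1≤k (ℕ.≤-refl {m})) 1≤n)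

      dim⊑1 : dim ⊑ 1
      dim⊑1 = ⊑1 (≤-trans (n≤x^n dim (fromℕ≤q (s≤s (s≤s z≤n)))) D≤B)

      Nn⊑1 : N ℕ.* n ⊑ 1
      Nn⊑1 = ⊑1 (begin
        fromℕ (N ℕ.* n)           ≈⟨ fromℕ-* N n ⟩
        fromℕ N * fromℕ n         ≤⟨ *-monoˡ-≤ (fromℕ-nonNegative n) N≤limit ⟩
        D * fromℕ k * fromℕ n     ≈⟨ trans (*-assoc D _ _) (*-congˡ (sym (fromℕ-* k n))) ⟩
        D * fromℕ (k ℕ.* n)       ≤⟨ *-monoʳ-≤ (1≤⇒0≤ 1≤D) (fromℕ-mono (ℕ.*-monoˡ-≤ n k≤km)) ⟩
        B                         ∎)
        where
        k≤km : k ℕ.≤ k ℕ.* m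
        k≤km = ≡.subst (ℕ._≤ k ℕ.* m) (ℕ.*-identityʳ k) (ℕ.*-monoʳ-≤ k 1≤m)

      N⊑1 : N ⊑ 1
      N⊑1 = bound (≤-trans
        (fromℕ-mono (≡.subst (ℕ._≤ N ℕ.* n) (ℕ.*-identityʳ N) (ℕ.*-monoʳ-≤ N 1≤n))) (_⊑_.≤bB Nn⊑1))

      infixr 6 _⊕_
      _⊕_ : ∀ {a a′ b b′} → N ℕ.* a ⊑ b → N ℕ.* a′ ⊑ b′ → N ℕ.* (a ℕ.+ a′) ⊑ b ℕ.+ b′
      _⊕_ {a} {a′} {b} {b′} a⊑b a′⊑b′ = ≡.subst (_⊑ b ℕ.+ b′) (≡.sym (ℕ.*-distribˡ-+ N a a′)) (⊑-+ a⊑b a′⊑b′)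

      perPoint : ∀ r → N ℕ.* (n ℕ.* r) ⊑ r
      perPoint r = ≡.subst (_⊑ r) (ℕ.*-assoc N n r) (⊑-* Nn⊑1 r)

      perRound : ∀ r → N ℕ.* r ⊑ r
      perRound = ⊑-* N⊑1

    -- A positive quota forces m, n ≥ 1, so that 1, m, `dim`, N and N n are each at most one unit
    -- `B`. The cost thus becomes a closed number of units, obtained by replacing every loop count
    -- by 1.
    running-time : fromℕ (programCost N) ≤ fromℕ constant * (D * fromℕ (k ℕ.* m ℕ.* n))
    running-time = _⊑_.≤bB
      (⊑-+ (⊑-+ (⊑-* m⊑1 21) (constant⊑ 7)) (⊑-+ (constant⊑ 5) (⊑-+ (constant⊑ 3)
      (⊑-+ (⊑-+ (⊑-* dim⊑1 22) (constant⊑ 7)) (⊑-+ rounds (constant⊑ 14))))))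
      where
      rounds : N ℕ.* (14 ℕ.+ roundCost) ⊑ _
      rounds = perRound 14 ⊕ perRound 3 ⊕ (perPoint 29 ⊕ perRound 7) ⊕
               perRound 3 ⊕ (perPoint 48 ⊕ perRound 7) ⊕ perRound 6

theorem5 :
    ∀ {c ℓ₁ ℓ₂ : Level} (F : OrderedField c ℓ₁ ℓ₂) →
    let open OrderedField F
        open Diversification F
        open RealRAM F
    in
    Σ[ C ∈ ℕ ] ∀ (ε : Carrier) → 0# < ε → ε ≤ 1# →
    Σ[ P ∈ Cmd ] ∀ (I : Instance) (dim : ℕ) →
    let open Instance I
        open Semantics I ε dim
        D = (fromℕ 8 / ε) ^ dim
    in
    IsDoublingDimension dim →
    Σ[ s ∈ State ] Σ[ t ∈ ℕ ]
      ( ⟨ P , initial ⟩⇓⟨ s , t ⟩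
      × IsCoreset (1# + ε) (output s)
      × fromℕ ∣ output {n} s ∣ ≤ fromℕ C * (D * fromℕ (k ℕ.* m))
      × (1 ℕ.≤ k → fromℕ t ≤ fromℕ C * (D * fromℕ (k ℕ.* m ℕ.* n))))
theorem5 F = constant , λ ε 0<ε ε≤1 → program , λ I dim (doubling , _) →
  let open OrderedField F
      open OrderedFieldProperties F
      open Coreset F 0<ε ε≤1 I dim doubling
      open Verification F I ε dim
      open Correctness F 0<ε ε≤1 I dim doubling
      N , s , t , program⇓ , ((L , sel) , stop) , t≤cost =
        run-program (*-nonNegative (1≤⇒0≤ 1≤D) (fromℕ-nonNegative (Diversification.Instance.k I)))
  in s , t , program⇓ , isCoreset (net sel stop) , output-size sel ,
     λ 1≤k → ≤-trans (fromℕ-mono t≤cost) (running-time N (Selected.bounded sel) 1≤k)
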